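{- Let $R\subseteq\mathbb N$ be infinite. Then $R$ is sparse if and only if $R$ is regular.
   Context: Enumerate $R$ increasingly as $(r_n)_{n\in\mathbb N}$; $\sigma:R\to R$ is the successor map $\sigma(r_n)=r_{n+1}$, $\sigma^k$ its $k$-fold iterate ($\sigma^0=\mathrm{id}$). An operator on $R$ is a function $R\to\mathbb Z$, $z\mapsto a_m\sigma^m(z)+\dots+a_0\sigma^0(z)$ with $a_i\in\mathbb Z$. For an operator $A$: $A=_R0$ if $Az=0$ for all $z\in R$; $A>_R0$ (resp. $A<_R0$) if $Az>0$ (resp. $Az<0$) for all but finitely many $z\in R$. $R$ is sparse if every operator $A$ satisfies (S1) $A=_R0$ or $A>_R0$ or $A<_R0$; and (S2) if $A>_R0$ then there is $\Delta\in\mathbb N$ with $A(\sigma^\Delta z)>z$ for all $z\in R$. $R$ is regular if $r_{n+1}/r_n\to\theta$ for some $\theta\in\mathbb R_{>1}\cup\{\infty\}$ and, whenever $\theta$ is algebraic over $\mathbb Q$ with minimal polynomial $f(x)=\sum_{i=0}^ka_ix^i$, we have $\sum_{i=0}^ka_ir_{n+i}=0$ for all $n\in\mathbb N$. -}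

module Defs where

open import Algebra.Bundles using (RawSemiring)
import Algebra.Definitions.RawMonoid as RawMonoidDefs
import Algebra.Definitions.RawSemiring as RawSemiringDefs
open import Axiom.ExcludedMiddle using (ExcludedMiddle)
open import Data.Fin.Base using (Fin; toℕ; fromℕ)
open import Data.Integer.Base as ℤ using (ℤ; +_; 0ℤ)
open import Data.List.Base using (List; upTo)
open import Data.List.Membership.Propositional using (_∈_)
open import Data.List.Membership.Propositional.Properties using (∈-upTo⁺)
open import Data.Nat.Base as ℕ using (ℕ; zero; suc)
open import Data.Nat.GeneralisedArithmetic using (fold)
import Data.Nat.Properties as ℕ
open import Data.Product.Base using (Σ; ∃; ∃-syntax; _×_; _,_; proj₁; proj₂)
open import Data.Rational.Base as ℚ using (ℚ; 0ℚ; 1ℚ; ½)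
import Data.Rational.Properties as ℚ
open import Data.Rational.Solver using (module +-*-Solver)
open import Data.Sum.Base using (_⊎_; inj₁; inj₂)
open import Data.Vec.Functional using (Vector)
open import Level using (0ℓ)
open import Relation.Binary.PropositionalEquality
  using (_≡_; _≢_; refl; sym; trans; cong; cong₂; subst; subst₂)
open import Relation.Nullary using (¬_; yes; no; contradiction)
open import Relation.Unary using (Pred; _⊆_)

------------------------------------------------------------------------
-- Real numbers: Cauchy sequences of rationals, with equality _≈_
-- "the difference tends to 0".

Eventually : Pred ℕ 0ℓ → Set
Eventually P = ∃[ N ] (∀ n → N ℕ.≤ n → P n)

IsCauchy : (ℕ → ℚ) → Set
IsCauchy s = ∀ ε → 0ℚ ℚ.< ε →
  ∃[ N ] (∀ m n → N ℕ.≤ m → N ℕ.≤ n → ℚ.∣ s m ℚ.- s n ∣ ℚ.< ε)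

record ℝ : Set where
  constructor mkℝ
  field
    seq    : ℕ → ℚ
    cauchy : IsCauchy seq

open ℝ public

infix 4 _≈_ _<_

_≈_ : ℝ → ℝ → Set
x ≈ y = ∀ ε → 0ℚ ℚ.< ε → Eventually λ n → ℚ.∣ seq x n ℚ.- seq y n ∣ ℚ.< ε

-- A uniform gap ε is required: termwise strict inequality is compatible
-- with x ≈ y.
_<_ : ℝ → ℝ → Set
x < y = ∃[ ε ] (0ℚ ℚ.< ε × Eventually λ n → seq x n ℚ.+ ε ℚ.≤ seq y n)

abstract
  half : ∀ {ε} → 0ℚ ℚ.< ε → 0ℚ ℚ.< ½ ℚ.* ε
  half {ε} 0<ε = subst (ℚ._< ½ ℚ.* ε) (ℚ.*-zeroʳ ½) (ℚ.*-monoʳ-<-pos ½ 0<ε)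

  halves : ∀ ε → ½ ℚ.* ε ℚ.+ ½ ℚ.* ε ≡ ε
  halves ε = trans (sym (ℚ.*-distribʳ-+ ε ½ ½)) (ℚ.*-identityˡ ε)

  const-cauchy : ∀ q → IsCauchy (λ _ → q)
  const-cauchy q ε 0<ε = 0 , λ _ _ _ _ →
    subst (λ t → ℚ.∣ t ∣ ℚ.< ε) (sym (ℚ.+-inverseʳ q)) 0<ε

  +-cauchy : ∀ {s t} → IsCauchy s → IsCauchy t → IsCauchy (λ n → s n ℚ.+ t n)
  +-cauchy {s} {t} cs ct ε 0<ε =
    let M , hM = cs (½ ℚ.* ε) (half 0<ε)
        N , hN = ct (½ ℚ.* ε) (half 0<ε)
    in M ℕ.⊔ N , λ m n m≥ n≥ →
      let open ℚ.≤-Reasoning in begin-strict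
        ℚ.∣ (s m ℚ.+ t m) ℚ.- (s n ℚ.+ t n) ∣
          ≡⟨ cong ℚ.∣_∣ (regroup (s m) (t m) (s n) (t n)) ⟩
        ℚ.∣ (s m ℚ.- s n) ℚ.+ (t m ℚ.- t n) ∣
          ≤⟨ ℚ.∣p+q∣≤∣p∣+∣q∣ (s m ℚ.- s n) (t m ℚ.- t n) ⟩
        ℚ.∣ s m ℚ.- s n ∣ ℚ.+ ℚ.∣ t m ℚ.- t n ∣
          <⟨ ℚ.+-mono-< (hM m n (ℕ.m⊔n≤o⇒m≤o M N m≥) (ℕ.m⊔n≤o⇒m≤o M N n≥))
                        (hN m n (ℕ.m⊔n≤o⇒n≤o M N m≥) (ℕ.m⊔n≤o⇒n≤o M N n≥)) ⟩
        ½ ℚ.* ε ℚ.+ ½ ℚ.* ε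
          ≡⟨ halves ε ⟩
        ε ∎
    where
    open +-*-Solver
    regroup : ∀ a b c d → (a ℚ.+ b) ℚ.- (c ℚ.+ d) ≡ (a ℚ.- c) ℚ.+ (b ℚ.- d)
    regroup = solve 4 (λ a b c d →
      (a :+ b) :- (c :+ d) := (a :- c) :+ (b :- d)) refl

  neg-cauchy : ∀ {s} → IsCauchy s → IsCauchy (λ n → ℚ.- s n)
  neg-cauchy {s} cs ε 0<ε =
    let N , h = cs ε 0<ε
    in N , λ m n m≥ n≥ →
      subst (ℚ._< ε)
        (trans (sym (ℚ.∣-p∣≡∣p∣ (s m ℚ.- s n)))
               (cong ℚ.∣_∣ (ℚ.neg-distrib-+ (s m) (ℚ.- s n))))
        (h m n m≥ n≥)

  ∣-∣-cauchy : ∀ {s} → IsCauchy s → IsCauchy (λ n → ℚ.∣ s n ∣)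
  ∣-∣-cauchy {s} cs ε 0<ε =
    let N , h = cs ε 0<ε
    in N , λ m n m≥ n≥ → ℚ.≤-<-trans (reverse (s m) (s n)) (h m n m≥ n≥)
    where
    open +-*-Solver
    cancel : ∀ a b → (a ℚ.- b) ℚ.+ b ≡ a
    cancel = solve 2 (λ a b → (a :- b) :+ b := a) refl
    uncancel : ∀ a b → (a ℚ.+ b) ℚ.- b ≡ a
    uncancel = solve 2 (λ a b → (a :+ b) :- b := a) refl
    swap : ∀ a b → ℚ.- (a ℚ.- b) ≡ b ℚ.- a
    swap = solve 2 (λ a b → :- (a :- b) := b :- a) refl
    one-sided : ∀ a b → ℚ.∣ a ∣ ℚ.- ℚ.∣ b ∣ ℚ.≤ ℚ.∣ a ℚ.- b ∣
    one-sided a b = subst₂ ℚ._≤_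
      (cong (λ t → ℚ.∣ t ∣ ℚ.- ℚ.∣ b ∣) (cancel a b))
      (uncancel ℚ.∣ a ℚ.- b ∣ ℚ.∣ b ∣)
      (ℚ.+-monoˡ-≤ (ℚ.- ℚ.∣ b ∣) (ℚ.∣p+q∣≤∣p∣+∣q∣ (a ℚ.- b) b))
    reverse : ∀ a b → ℚ.∣ ℚ.∣ a ∣ ℚ.- ℚ.∣ b ∣ ∣ ℚ.≤ ℚ.∣ a ℚ.- b ∣
    reverse a b with ℚ.∣p∣≡p∨∣p∣≡-p (ℚ.∣ a ∣ ℚ.- ℚ.∣ b ∣)
    ... | inj₁ e = subst (ℚ._≤ ℚ.∣ a ℚ.- b ∣) (sym e) (one-sided a b)
    ... | inj₂ e = subst₂ ℚ._≤_
      (sym (trans e (swap ℚ.∣ a ∣ ℚ.∣ b ∣)))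
      (trans (sym (ℚ.∣-p∣≡∣p∣ (b ℚ.- a))) (cong ℚ.∣_∣ (swap b a)))
      (one-sided b a)

  cauchy⇒bounded : ∀ {s} → IsCauchy s →
    ∃[ B ] (0ℚ ℚ.< B × Eventually λ n → ℚ.∣ s n ∣ ℚ.≤ B)
  cauchy⇒bounded {s} cs =
    let N , h = cs 1ℚ (ℚ.positive⁻¹ 1ℚ)
    in 1ℚ ℚ.+ ℚ.∣ s N ∣
     , ℚ.+-mono-<-≤ (ℚ.positive⁻¹ 1ℚ) (ℚ.0≤∣p∣ (s N))
     , N , λ n n≥ → let open ℚ.≤-Reasoning in begin
        ℚ.∣ s n ∣                          ≡⟨ cong ℚ.∣_∣ (split (s n) (s N)) ⟩
        ℚ.∣ (s n ℚ.- s N) ℚ.+ s N ∣        ≤⟨ ℚ.∣p+q∣≤∣p∣+∣q∣ (s n ℚ.- s N) (s N) ⟩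
        ℚ.∣ s n ℚ.- s N ∣ ℚ.+ ℚ.∣ s N ∣    ≤⟨ ℚ.+-monoˡ-≤ ℚ.∣ s N ∣
                                                (ℚ.<⇒≤ (h n N n≥ ℕ.≤-refl)) ⟩
        1ℚ ℚ.+ ℚ.∣ s N ∣                   ∎
    where
    open +-*-Solver
    split : ∀ a b → a ≡ (a ℚ.- b) ℚ.+ b
    split = solve 2 (λ a b → a := (a :- b) :+ b) refl

  -- For B, ε > 0 some δ > 0 satisfies: |p| ≤ B and |q| < δ imply |p q| < ε.
  shrink : ∀ B ε → 0ℚ ℚ.< B → 0ℚ ℚ.< ε → ∃[ δ ] (0ℚ ℚ.< δ ×
    (∀ p q → ℚ.∣ p ∣ ℚ.≤ B → ℚ.∣ q ∣ ℚ.< δ → ℚ.∣ p ℚ.* q ∣ ℚ.< ε))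
  shrink B ε 0<B 0<ε = ε ℚ.* B⁻¹
    , ℚ.positive⁻¹ (ε ℚ.* B⁻¹) {{ℚ.pos*pos⇒pos ε {{ε⁺}} B⁻¹ {{ℚ.1/pos⇒pos B {{B⁺}}}}}}
    , λ p q p≤B q<δ → let open ℚ.≤-Reasoning in begin-strict
        ℚ.∣ p ℚ.* q ∣           ≡⟨ ℚ.∣p*q∣≡∣p∣*∣q∣ p q ⟩
        ℚ.∣ p ∣ ℚ.* ℚ.∣ q ∣     ≤⟨ ℚ.*-monoʳ-≤-nonNeg ℚ.∣ q ∣
                                    {{ℚ.nonNegative (ℚ.0≤∣p∣ q)}} p≤B ⟩
        B ℚ.* ℚ.∣ q ∣           <⟨ ℚ.*-monoʳ-<-pos B {{B⁺}} q<δ ⟩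
        B ℚ.* (ε ℚ.* B⁻¹)       ≡⟨ cong (B ℚ.*_) (ℚ.*-comm ε B⁻¹) ⟩
        B ℚ.* (B⁻¹ ℚ.* ε)       ≡⟨ sym (ℚ.*-assoc B B⁻¹ ε) ⟩
        B ℚ.* B⁻¹ ℚ.* ε         ≡⟨ cong (ℚ._* ε) (ℚ.*-inverseʳ B {{B≢0}}) ⟩
        1ℚ ℚ.* ε                ≡⟨ ℚ.*-identityˡ ε ⟩
        ε                       ∎
    where
    B⁺ : ℚ.Positive B
    B⁺ = ℚ.positive 0<B
    ε⁺ : ℚ.Positive ε
    ε⁺ = ℚ.positive 0<ε
    B≢0 : ℚ.NonZero B
    B≢0 = ℚ.pos⇒nonZero B {{B⁺}}
    B⁻¹ : ℚ
    B⁻¹ = (ℚ.1/ B) {{B≢0}}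

  *-cauchy : ∀ {s t} → IsCauchy s → IsCauchy t → IsCauchy (λ n → s n ℚ.* t n)
  *-cauchy {s} {t} cs ct ε 0<ε =
    let B , 0<B , K , hB = cauchy⇒bounded cs
        C , 0<C , L , hC = cauchy⇒bounded ct
        δ , 0<δ , hδ = shrink B (½ ℚ.* ε) 0<B (half 0<ε)
        η , 0<η , hη = shrink C (½ ℚ.* ε) 0<C (half 0<ε)
        M , hM = ct δ 0<δ
        N , hN = cs η 0<η
        below : ∀ {m} → (K ℕ.⊔ L) ℕ.⊔ (M ℕ.⊔ N) ℕ.≤ m →
                (K ℕ.≤ m × L ℕ.≤ m) × (M ℕ.≤ m × N ℕ.≤ m)
        below h = let l = ℕ.m⊔n≤o⇒m≤o (K ℕ.⊔ L) (M ℕ.⊔ N) h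
                      r = ℕ.m⊔n≤o⇒n≤o (K ℕ.⊔ L) (M ℕ.⊔ N) h
                  in (ℕ.m⊔n≤o⇒m≤o K L l , ℕ.m⊔n≤o⇒n≤o K L l)
                   , (ℕ.m⊔n≤o⇒m≤o M N r , ℕ.m⊔n≤o⇒n≤o M N r)
    in (K ℕ.⊔ L) ℕ.⊔ (M ℕ.⊔ N) , λ m n m≥ n≥ →
      let (K≤m , _) , (M≤m , N≤m) = below m≥
          (_ , L≤n) , (M≤n , N≤n) = below n≥
          open ℚ.≤-Reasoning
      in begin-strict
        ℚ.∣ s m ℚ.* t m ℚ.- s n ℚ.* t n ∣
          ≡⟨ cong ℚ.∣_∣ (regroup (s m) (t m) (s n) (t n)) ⟩
        ℚ.∣ s m ℚ.* (t m ℚ.- t n) ℚ.+ t n ℚ.* (s m ℚ.- s n) ∣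
          ≤⟨ ℚ.∣p+q∣≤∣p∣+∣q∣ (s m ℚ.* (t m ℚ.- t n)) (t n ℚ.* (s m ℚ.- s n)) ⟩
        ℚ.∣ s m ℚ.* (t m ℚ.- t n) ∣ ℚ.+ ℚ.∣ t n ℚ.* (s m ℚ.- s n) ∣
          <⟨ ℚ.+-mono-<
               (hδ (s m) (t m ℚ.- t n) (hB m K≤m) (hM m n M≤m M≤n))
               (hη (t n) (s m ℚ.- s n) (hC n L≤n) (hN m n N≤m N≤n)) ⟩
        ½ ℚ.* ε ℚ.+ ½ ℚ.* ε
          ≡⟨ halves ε ⟩
        ε ∎
    where
    open +-*-Solver
    regroup : ∀ a b c d →
      a ℚ.* b ℚ.- c ℚ.* d ≡ a ℚ.* (b ℚ.- d) ℚ.+ d ℚ.* (a ℚ.- c)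
    regroup = solve 4 (λ a b c d →
      a :* b :- c :* d := a :* (b :- d) :+ d :* (a :- c)) refl

fromℚ : ℚ → ℝ
fromℚ q = mkℝ (λ _ → q) (const-cauchy q)

0ℝ 1ℝ : ℝ
0ℝ = fromℚ 0ℚ
1ℝ = fromℚ 1ℚ

infixl 6 _+_ _-_
infixl 7 _*_
infix  8 -_

_+_ : ℝ → ℝ → ℝ
x + y = mkℝ (λ n → seq x n ℚ.+ seq y n) (+-cauchy {seq x} {seq y} (cauchy x) (cauchy y))

_*_ : ℝ → ℝ → ℝ
x * y = mkℝ (λ n → seq x n ℚ.* seq y n) (*-cauchy {seq x} {seq y} (cauchy x) (cauchy y))

-_ : ℝ → ℝ
- x = mkℝ (λ n → ℚ.- seq x n) (neg-cauchy {seq x} (cauchy x))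

_-_ : ℝ → ℝ → ℝ
x - y = x + (- y)

∣_∣ : ℝ → ℝ
∣ x ∣ = mkℝ (λ n → ℚ.∣ seq x n ∣) (∣-∣-cauchy {seq x} (cauchy x))

ℝ-rawSemiring : RawSemiring 0ℓ 0ℓ
ℝ-rawSemiring = record
  { Carrier = ℝ ; _≈_ = _≈_ ; _+_ = _+_ ; _*_ = _*_ ; 0# = 0ℝ ; 1# = 1ℝ }

module ℝ-Alg = RawSemiringDefs ℝ-rawSemiring
module ℚ-Sum = RawMonoidDefs ℚ.+-0-rawMonoid
module ℤ-Sum = RawMonoidDefs ℤ.+-0-rawMonoid

_⟶_ : (ℕ → ℚ) → ℝ → Set
q ⟶ x = ∀ ε → 0ℝ < ε → Eventually λ n → ∣ fromℚ (q n) - x ∣ < ε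

_⟶∞ : (ℕ → ℚ) → Set
q ⟶∞ = ∀ M → Eventually λ n → M < fromℚ (q n)

------------------------------------------------------------------------
-- Minimal polynomials over ℚ.  A vector a of length k+1 stands for
-- a₀ + a₁ x + … + a_k x^k.

eval : ∀ {k} → Vector ℚ (suc k) → ℝ → ℝ
eval a x = ℝ-Alg.sum λ i → fromℚ (a i) * (x ℝ-Alg.^ toℕ i)

-- The monic polynomial of least degree among the nonzero rational
-- polynomials vanishing at x.
record IsMinimalPolynomial {k} (a : Vector ℚ (suc k)) (x : ℝ) : Set where
  field
    monic   : a (fromℕ k) ≡ 1ℚ
    root    : eval a x ≈ 0ℝ
    minimal : ∀ m (b : Vector ℚ (suc m)) →
              b (fromℕ m) ≢ 0ℚ → eval b x ≈ 0ℝ → k ℕ.≤ m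

------------------------------------------------------------------------
-- Infinite subsets of ℕ and their increasing enumeration.  Excluded middle
-- is used to find least elements of subsets of ℕ.

Finite : Pred ℕ 0ℓ → Set
Finite P = ∃[ xs ] P ⊆ (_∈ xs)

Infinite : Pred ℕ 0ℓ → Set
Infinite P = ¬ Finite P

record Enumeration (R : Pred ℕ 0ℓ) : Set where
  field
    r          : ℕ → ℕ
    r∈R        : ∀ n → R (r n)
    increasing : ∀ n → r n ℕ.< r (suc n)
    index      : ∀ {z} → R z → ℕ
    r-index    : ∀ {z} (z∈R : R z) → r (index z∈R) ≡ z

module _ (em : ExcludedMiddle 0ℓ) {R : Pred ℕ 0ℓ} (inf : Infinite R) where

  private
    LeastFrom : ℕ → ℕ → Set
    LeastFrom n z = n ℕ.≤ z × R z × (∀ y → n ℕ.≤ y → R y → z ℕ.≤ y)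

    search : ∀ k n → R (k ℕ.+ n) → ∃ (LeastFrom n)
    search k n p with em {R n}
    search k       n p | yes q = n , ℕ.≤-refl , q , λ _ n≤y _ → n≤y
    search zero    n p | no ¬q = contradiction p ¬q
    search (suc k) n p | no ¬q =
      let z , n<z , z∈R , least = search k (suc n) (subst R (sym (ℕ.+-suc k n)) p)
      in z , ℕ.<⇒≤ n<z , z∈R , λ y n≤y y∈R →
           least y (ℕ.≤∧≢⇒< n≤y λ { refl → ¬q y∈R }) y∈R

    unbounded : ∀ n → ∃[ k ] R (k ℕ.+ n)
    unbounded n with em {∃[ k ] R (k ℕ.+ n)}
    ... | yes p = p
    ... | no ¬p = contradiction (upTo n , λ {z} → below {z}) inf
      where
      below : ∀ {z} → R z → z ∈ upTo n
      below {z} z∈R with n ℕ.≤? z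
      ... | yes n≤z = contradiction
        (z ℕ.∸ n , subst R (sym (ℕ.m∸n+n≡m n≤z)) z∈R) ¬p
      ... | no n≰z = ∈-upTo⁺ (ℕ.≰⇒> n≰z)

    next : ∀ n → ∃ (LeastFrom n)
    next n = let k , p = unbounded n in search k n p

    enum : ℕ → ℕ
    enum zero    = proj₁ (next 0)
    enum (suc n) = proj₁ (next (suc (enum n)))

    enum∈R : ∀ n → R (enum n)
    enum∈R zero    = proj₁ (proj₂ (proj₂ (next 0)))
    enum∈R (suc n) = proj₁ (proj₂ (proj₂ (next (suc (enum n)))))

    enum-increasing : ∀ n → enum n ℕ.< enum (suc n)
    enum-increasing n = proj₁ (proj₂ (next (suc (enum n))))

    n≤enum : ∀ n → n ℕ.≤ enum n
    n≤enum zero    = ℕ.z≤n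
    n≤enum (suc n) = ℕ.≤-<-trans (n≤enum n) (enum-increasing n)

    cover : ∀ n {z} → R z → (∃[ j ] enum j ≡ z) ⊎ enum n ℕ.≤ z
    cover zero    z∈R = inj₂ (proj₂ (proj₂ (proj₂ (next 0))) _ ℕ.z≤n z∈R)
    cover (suc n) {z} z∈R with cover n z∈R
    ... | inj₁ found = inj₁ found
    ... | inj₂ below with enum n ℕ.≟ z
    ...   | yes eq = inj₁ (n , eq)
    ...   | no ¬eq = inj₂ (proj₂ (proj₂ (proj₂ (next (suc (enum n))))) z
                              (ℕ.≤∧≢⇒< below ¬eq) z∈R)

    onto : ∀ {z} → R z → ∃[ j ] enum j ≡ z
    onto {z} z∈R with cover (suc z) z∈R
    ... | inj₁ found = found
    ... | inj₂ below = contradiction (ℕ.≤-trans (n≤enum (suc z)) below) ℕ.1+n≰n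

  enumeration : Enumeration R
  enumeration = record
    { r          = enum
    ; r∈R        = enum∈R
    ; increasing = enum-increasing
    ; index      = λ z∈R → proj₁ (onto z∈R)
    ; r-index    = λ z∈R → proj₂ (onto z∈R)
    }

------------------------------------------------------------------------
-- Sparse and regular sets

module _ {R : Pred ℕ 0ℓ} (e : Enumeration R) where
  open Enumeration e

  σ : ∃ R → ∃ R
  σ (_ , z∈R) = r (suc (index z∈R)) , r∈R (suc (index z∈R))

  σ^ : ℕ → ∃ R → ∃ R
  σ^ k z = fold z σ k

  operator : ∀ {m} → Vector ℤ (suc m) → ∃ R → ℤ
  operator a z = ℤ-Sum.sum λ i → a i ℤ.* + proj₁ (σ^ (toℕ i) z)

  -- The exceptional set is a set of naturals, not of pairs (z , z∈R):
  -- membership proofs must not count.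
  AllButFinitelyMany : Pred (∃ R) 0ℓ → Set
  AllButFinitelyMany P = Finite λ z → Σ (R z) λ z∈R → ¬ P (z , z∈R)

  _=ᴿ0 _>ᴿ0 _<ᴿ0 : (∃ R → ℤ) → Set
  A =ᴿ0 = ∀ z → A z ≡ 0ℤ
  A >ᴿ0 = AllButFinitelyMany λ z → A z ℤ.> 0ℤ
  A <ᴿ0 = AllButFinitelyMany λ z → A z ℤ.< 0ℤ

  record Sparse : Set where
    field
      S1 : ∀ m (a : Vector ℤ (suc m)) → let A = operator a in
           A =ᴿ0 ⊎ A >ᴿ0 ⊎ A <ᴿ0
      S2 : ∀ m (a : Vector ℤ (suc m)) → let A = operator a in
           A >ᴿ0 → ∃[ Δ ] (∀ z → A (σ^ Δ z) ℤ.> + proj₁ z)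

  -- The value 0 at a zero denominator is a convention; it can only be used
  -- for n = 0, so it does not affect the limit.
  quotient : ℕ → ℕ → ℚ
  quotient p zero    = 0ℚ
  quotient p (suc q) = + p ℚ./ suc q

  ratio : ℕ → ℚ
  ratio n = quotient (r (suc n)) (r n)

  -- No condition on recurrences when θ = ∞, since ∞ is not algebraic.  A
  -- real θ is algebraic exactly when it has a minimal polynomial.
  Regular : Set
  Regular =
    (∃[ θ ] (1ℝ < θ × ratio ⟶ θ ×
      (∀ k (a : Vector ℚ (suc k)) → IsMinimalPolynomial a θ →
        ∀ n → ℚ-Sum.sum (λ i → a i ℚ.* (+ r (n ℕ.+ toℕ i) ℚ./ 1)) ≡ 0ℚ)))
    ⊎ ratio ⟶∞

{-# OPTIONS --safe #-}
module Submission where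

-- Let A be an operator with coefficients a.  If r (n + 1) / r n → θ < ∞,
-- then A (r n) / r n → a(θ), where a is read as a polynomial, so A has constant
-- sign, and grows like r n, as soon as a(θ) ≠ 0; if a(θ) = 0, the minimal
-- polynomial of θ divides a and its recurrence gives A = 0.  If θ = ∞, the
-- leading term of A dominates.
--
-- Conversely, (S1) for the operators q σ - p decides on which side of p / q
-- the quotients r (n + 1) / r n eventually lie, so they converge or tend
-- to ∞.  (S2) for σ - 1 excludes the limit 1.  If f(θ) = 0, then the operator F
-- of f satisfies F (r n) = o(r n), which by (S2) excludes F > 0 and F < 0, so
-- (S1) leaves F = 0.

open import Defs hiding (_<_; _+_; _*_; -_; _-_; ∣_∣)
open import Algebra.Bundles using (CommutativeRing)
import Algebra.Properties.Monoid.Sum as MonoidSum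
import Algebra.Properties.Semiring.Exp as SemiringExp
import Algebra.Properties.Semiring.Sum as SemiringSum
open import Axiom.ExcludedMiddle using (ExcludedMiddle)
open import Axiom.DoubleNegationElimination using (em⇒dne)
open import Data.Empty using (⊥)
open import Data.Fin.Base using (zero; suc; toℕ; fromℕ; inject₁)
open import Data.Integer.Base as ℤ using (ℤ; 0ℤ)
import Data.Integer.Properties as ℤ
open import Data.Nat.Base as ℕ using (ℕ; zero; suc)
import Data.Nat.Properties as ℕ
open import Data.List.Base using (upTo)
open import Data.List.Extrema.Nat using (max; xs≤max)
open import Data.List.Membership.Propositional.Properties using (∈-upTo⁺)
open import Data.List.Relation.Unary.All using (lookup)
open import Data.Nat.Coprimality using (1-coprimeTo) renaming (sym to coprime-sym)
open import Data.Product.Base using (Σ; ∃; ∃-syntax; _×_; _,_; proj₁)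
open import Data.Rational.Base as ℚ
  using (ℚ; mkℚ; 0ℚ; 1ℚ; ½; _+_; _*_; _-_; -_; _<_; _≤_; ∣_∣; _/_; *<*)
import Data.Rational.Properties as ℚ
open import Data.Rational.Unnormalised.Base as ℚᵘ using (mkℚᵘ; *≡*)
import Data.Rational.Unnormalised.Properties as ℚᵘ
open import Data.Rational.Solver using (module +-*-Solver)
open import Data.Sum.Base using (_⊎_; inj₁; inj₂)
open import Data.Vec.Functional using (Vector)
open import Function.Bundles using (_⇔_; mk⇔)
open import Level using (0ℓ)
open import Relation.Binary.PropositionalEquality
  using (_≡_; _≢_; refl; sym; trans; cong; cong₂; subst; subst₂; module ≡-Reasoning)
open import Relation.Binary.Definitions using (Tri; tri<; tri≈; tri>)
open import Relation.Nullary using (¬_; Dec; yes; no; contradiction)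
open import Relation.Nullary.Decidable using (decidable-stable)
open import Relation.Unary using (Pred)

open SemiringExp (CommutativeRing.semiring ℚ.+-*-commutativeRing) using (_^_; ^-homo-*)
open SemiringSum (CommutativeRing.semiring ℚ.+-*-commutativeRing) using (sum-cong-≗; *-distribˡ-sum)

-- Positivity of an operator A alone does not give (S2). The forward direction therefore proves
-- more: A or -A is eventually at least c * `s n` for a fixed c > 0, unless A = 0. Growth by a
-- factor 1 + δ at every late step then makes up for a small c. In the converse, (S2) compares A at
-- index n + Δ with the earlier term `s n`. Once the quotients are known to be bounded, `s n` is at
-- least a fixed multiple of `s (n + Δ)`, so (S2) becomes a lower bound for A / s at a single index.
-- This one device yields both θ > 1 and the recurrence. Operators carry rational coefficients in
-- the main argument, so that polynomial division and comparison with a rational q are direct;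
-- denominators are cleared where sparseness enters. Since R may contain 0, quotients are trusted
-- from index 1 on, hence the many statements at `suc n`.

private variable
  x y z d ε : ℚ
  k m : ℕ
  u v : ℕ → ℚ
  P Q S : Pred ℕ 0ℓ

-- Ordered field arithmetic.  Polynomial inequalities are proved by exhibiting
-- the gap between the two sides as a combination of nonnegative terms.

≤-gap : 0ℚ ≤ d → y ≡ x + d → x ≤ y
≤-gap {x = x} 0≤d refl = subst (_≤ x + _) (ℚ.+-identityʳ x) (ℚ.+-monoʳ-≤ x 0≤d)

<-gap : 0ℚ < d → y ≡ x + d → x < y
<-gap {x = x} 0<d refl = subst (_< x + _) (ℚ.+-identityʳ x) (ℚ.+-monoʳ-< x 0<d)

gap-≤ : x ≤ y → 0ℚ ≤ y - x
gap-≤ {x} {y} h = subst (_≤ y - x) (ℚ.+-inverseʳ x) (ℚ.+-monoˡ-≤ (- x) h)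

gap-< : x < y → 0ℚ < y - x
gap-< {x} {y} h = subst (_< y - x) (ℚ.+-inverseʳ x) (ℚ.+-monoˡ-< (- x) h)

0≤+ : 0ℚ ≤ x → 0ℚ ≤ y → 0ℚ ≤ x + y
0≤+ = ℚ.+-mono-≤

0<+ : 0ℚ < x → 0ℚ ≤ y → 0ℚ < x + y
0<+ = ℚ.+-mono-<-≤

0≤* : 0ℚ ≤ x → 0ℚ ≤ y → 0ℚ ≤ x * y
0≤* {x} {y} 0≤x 0≤y = ℚ.nonNegative⁻¹ (x * y)
  {{ℚ.nonNeg*nonNeg⇒nonNeg x {{ℚ.nonNegative 0≤x}} y {{ℚ.nonNegative 0≤y}}}}

0<* : 0ℚ < x → 0ℚ < y → 0ℚ < x * y
0<* {x} {y} 0<x 0<y = ℚ.positive⁻¹ (x * y)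
  {{ℚ.pos*pos⇒pos x {{ℚ.positive 0<x}} y {{ℚ.positive 0<y}}}}

0<1 : 0ℚ < 1ℚ
0<1 = ℚ.positive⁻¹ 1ℚ

*-cancel-≤ : 0ℚ < z → x * z ≤ y * z → x ≤ y
*-cancel-≤ {z} 0<z = ℚ.*-cancelʳ-≤-pos z {{ℚ.positive 0<z}}

*-mono-≤ : 0ℚ ≤ z → x ≤ y → z * x ≤ z * y
*-mono-≤ {z} 0≤z = ℚ.*-monoˡ-≤-nonNeg z {{ℚ.nonNegative 0≤z}}

*-mono-< : 0ℚ < z → x < y → z * x < z * y
*-mono-< {z} 0<z = ℚ.*-monoʳ-<-pos z {{ℚ.positive 0<z}}

*-cancel-0 : 0ℚ < z → z * x ≡ 0ℚ → x ≡ 0ℚ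
*-cancel-0 {z} {x} 0<z eq = ℚ.≤-antisym
  (*-cancel-≤ 0<z (ℚ.≤-reflexive eq′)) (*-cancel-≤ 0<z (ℚ.≤-reflexive (sym eq′)))
  where
  eq′ : x * z ≡ 0ℚ * z
  eq′ = trans (ℚ.*-comm x z) (trans eq (sym (ℚ.*-zeroˡ z)))

inverse : ∀ x → x ≢ 0ℚ → ∃[ y ] y * x ≡ 1ℚ
inverse x x≢0 = (ℚ.1/ x) {{ℚ.≢-nonZero x≢0}} , ℚ.*-inverseˡ x {{ℚ.≢-nonZero x≢0}}

inverse-pos : 0ℚ < x → ∃[ y ] (0ℚ < y × y * x ≡ 1ℚ)
inverse-pos {x} 0<x =
    (ℚ.1/ x) {{x≢0}}
  , ℚ.positive⁻¹ _ {{ℚ.1/pos⇒pos x {{ℚ.positive 0<x}}}}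
  , ℚ.*-inverseˡ x {{x≢0}}
  where
  x≢0 : ℚ.NonZero x
  x≢0 = ℚ.pos⇒nonZero x {{ℚ.positive 0<x}}

∣∣<⇒< : ∣ x ∣ < ε → x < ε
∣∣<⇒< {x} {ε} h with ℚ.∣p∣≡p∨∣p∣≡-p x
... | inj₁ eq = subst (_< ε) eq h
... | inj₂ eq with ℚ.≤-total x 0ℚ
...   | inj₁ x≤0 = ℚ.≤-<-trans x≤0 (ℚ.≤-<-trans (ℚ.0≤∣p∣ x) h)
...   | inj₂ 0≤x = subst (_< ε) (ℚ.0≤p⇒∣p∣≡p 0≤x) h

∣∣<⇒-< : ∣ x ∣ < ε → - x < ε
∣∣<⇒-< {x} {ε} h = ∣∣<⇒< (subst (_< ε) (sym (ℚ.∣-p∣≡∣p∣ x)) h)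

∣∣≤-intro : x ≤ ε → - x ≤ ε → ∣ x ∣ ≤ ε
∣∣≤-intro {x} {ε} h₁ h₂ with ℚ.∣p∣≡p∨∣p∣≡-p x
... | inj₁ eq = subst (_≤ ε) (sym eq) h₁
... | inj₂ eq = subst (_≤ ε) (sym eq) h₂

neg-involutive : ∀ x → - - x ≡ x
neg-involutive = solve 1 (λ x → :- :- x := x) refl
  where open +-*-Solver

*-cancel-<ˡ : 0ℚ < z → z * x < z * y → x < y
*-cancel-<ˡ {z} 0<z = ℚ.*-cancelˡ-<-nonNeg z {{ℚ.nonNegative (ℚ.<⇒≤ 0<z)}}

+-cancel : ∀ x y → (x - y) + y ≡ x
+-cancel = solve 2 (λ x y → (x :- y) :+ y := x) refl
  where open +-*-Solver

telescope : ∀ x y z → (x - y) + (y - z) ≡ x - z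
telescope = solve 3 (λ x y z → (x :- y) :+ (y :- z) := x :- z) refl
  where open +-*-Solver

neg-minus : ∀ x y → - (x - y) ≡ y - x
neg-minus = solve 2 (λ x y → :- (x :- y) := y :- x) refl
  where open +-*-Solver

swap : ∀ x y z → x * (y * z) ≡ y * (x * z)
swap = solve 3 (λ x y z → x :* (y :* z) := y :* (x :* z)) refl
  where open +-*-Solver

-- The embedding of the integers

intℚ : ℤ → ℚ
intℚ i = mkℚ i 0 (coprime-sym (1-coprimeTo ℤ.∣ i ∣))

intℚ-/1 : ∀ i → i / 1 ≡ intℚ i
intℚ-/1 i = ℚ.↥p/↧p≡p (intℚ i)

natℚ : ℕ → ℚ
natℚ n = intℚ (ℤ.+ n)

intℚ-+ : ∀ i j → intℚ (i ℤ.+ j) ≡ intℚ i + intℚ j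
intℚ-+ i j = trans (sym (intℚ-/1 (i ℤ.+ j)))
  (cong (_/ 1) (sym (cong₂ ℤ._+_ (ℤ.*-identityʳ i) (ℤ.*-identityʳ j))))

intℚ-* : ∀ i j → intℚ (i ℤ.* j) ≡ intℚ i * intℚ j
intℚ-* i j = sym (intℚ-/1 (i ℤ.* j))

intℚ-mono-< : ∀ {i j} → i ℤ.< j → intℚ i < intℚ j
intℚ-mono-< {i} {j} i<j =
  *<* (subst₂ ℤ._<_ (sym (ℤ.*-identityʳ i)) (sym (ℤ.*-identityʳ j)) i<j)

intℚ-cancel-< : ∀ {i j} → intℚ i < intℚ j → i ℤ.< j
intℚ-cancel-< {i} {j} h = subst₂ ℤ._<_ (ℤ.*-identityʳ i) (ℤ.*-identityʳ j) (ℚ.drop-*<* h)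

intℚ-injective : ∀ {i j} → intℚ i ≡ intℚ j → i ≡ j
intℚ-injective = cong ℚ.↥_

natℚ-suc : ∀ n → natℚ (suc n) ≡ 1ℚ + natℚ n
natℚ-suc n = intℚ-+ (ℤ.+ 1) (ℤ.+ n)

q*[p/q]≡p : ∀ i d-1 → intℚ (ℤ.+ suc d-1) * (i / suc d-1) ≡ intℚ i
q*[p/q]≡p i d-1 = ℚ.toℚᵘ-injective (begin
  ℚ.toℚᵘ (intℚ (ℤ.+ suc d-1) * (i / suc d-1))
    ≈⟨ ℚ.toℚᵘ-homo-* (intℚ (ℤ.+ suc d-1)) (i / suc d-1) ⟩
  mkℚᵘ (ℤ.+ suc d-1) 0 ℚᵘ.* ℚ.toℚᵘ (i / suc d-1)
    ≈⟨ ℚᵘ.*-congˡ {mkℚᵘ (ℤ.+ suc d-1) 0} (ℚ.toℚᵘ-fromℚᵘ (mkℚᵘ i d-1)) ⟩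
  mkℚᵘ (ℤ.+ suc d-1) 0 ℚᵘ.* mkℚᵘ i d-1
    ≈⟨ *≡* eq ⟩
  mkℚᵘ i 0 ∎)
  where
  open ℚᵘ.≃-Reasoning
  eq : ℤ.+ suc d-1 ℤ.* i ℤ.* ℤ.+ 1 ≡ i ℤ.* ℤ.+ suc (d-1 ℕ.+ 0)
  eq = trans (ℤ.*-identityʳ (ℤ.+ suc d-1 ℤ.* i)) (trans (ℤ.*-comm (ℤ.+ suc d-1) i)
    (cong (λ t → i ℤ.* ℤ.+ suc t) (sym (ℕ.+-identityʳ d-1))))

denominator-* : ∀ x → intℚ (ℚ.↧ x) * x ≡ intℚ (ℚ.↥ x)
denominator-* x = trans (cong (intℚ (ℚ.↧ x) *_) (sym (ℚ.↥p/↧p≡p x)))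
  (q*[p/q]≡p (ℚ.↥ x) (ℚ.denominator-1 x))

archimedean : ∀ x → ∃[ n ] x < natℚ n
archimedean (mkℚ i d-1 _) = suc ℤ.∣ i ∣ , *<* (begin-strict
  i ℤ.* ℤ.+ 1                          ≡⟨ ℤ.*-identityʳ i ⟩
  i                                    ≤⟨ i≤∣i∣ i ⟩
  ℤ.+ ℤ.∣ i ∣                          <⟨ ℤ.+<+ (ℕ.n<1+n _) ⟩
  ℤ.+ suc ℤ.∣ i ∣                      ≤⟨ ℤ.+≤+ (ℕ.m≤m*n (suc ℤ.∣ i ∣) (suc d-1)) ⟩
  ℤ.+ (suc ℤ.∣ i ∣ ℕ.* suc d-1)        ≡⟨ ℤ.pos-* (suc ℤ.∣ i ∣) (suc d-1) ⟩
  ℤ.+ suc ℤ.∣ i ∣ ℤ.* ℤ.+ suc d-1      ∎)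
  where
  open ℤ.≤-Reasoning
  i≤∣i∣ : ∀ i → i ℤ.≤ ℤ.+ ℤ.∣ i ∣
  i≤∣i∣ (ℤ.+ n)    = ℤ.≤-refl
  i≤∣i∣ ℤ.-[1+ n ] = ℤ.-≤+

archimedean-* : 0ℚ < ε → ∀ x → ∃[ n ] x < natℚ n * ε
archimedean-* {ε} 0<ε x =
  let y , 0<y , yε≡1 = inverse-pos 0<ε
      n , xy<n = archimedean (x * y)
  in n , subst (_< natℚ n * ε)
       (trans (ℚ.*-assoc x y ε) (trans (cong (x *_) yε≡1) (ℚ.*-identityʳ x)))
       (ℚ.*-monoˡ-<-pos ε {{ℚ.positive 0<ε}} xy<n)

-- Eventual properties and null sequences

ev-map : (∀ n → P n → Q n) → Eventually P → Eventually Q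
ev-map f (N , h) = N , λ n N≤n → f n (h n N≤n)

ev-map₂ : (∀ n → P n → Q n → S n) → Eventually P → Eventually Q → Eventually S
ev-map₂ f (M , g) (N , h) = M ℕ.⊔ N , λ n le →
  f n (g n (ℕ.m⊔n≤o⇒m≤o M N le)) (h n (ℕ.m⊔n≤o⇒n≤o M N le))

ev-all : (∀ n → P n) → Eventually P
ev-all f = 0 , λ n _ → f n

ev-+ : ∀ j → Eventually P → Eventually (λ n → P (n ℕ.+ j))
ev-+ j (N , h) = N , λ n N≤n → h (n ℕ.+ j) (ℕ.≤-trans N≤n (ℕ.m≤m+n n j))

ev-suc : Eventually P → Eventually (λ n → P (suc n))
ev-suc (N , h) = N , λ n N≤n → h (suc n) (ℕ.m≤n⇒m≤1+n N≤n)

ev-unshift : ∀ j → Eventually (λ n → P (n ℕ.+ j)) → Eventually P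
ev-unshift {P} j (N , h) = N ℕ.+ j , λ n N+j≤n →
  subst P (ℕ.m∸n+n≡m (ℕ.≤-trans (ℕ.m≤n+m j N) N+j≤n))
    (h (n ℕ.∸ j) (ℕ.m+n≤o⇒m≤o∸n N N+j≤n))

ev-pred : Eventually (λ n → P (suc n)) → Eventually P
ev-pred (N , h) = suc N , λ { (suc n) N<n → h n (ℕ.s≤s⁻¹ N<n) }

ev-⊥ : Eventually (λ _ → ⊥) → ⊥
ev-⊥ (N , h) = h N ℕ.≤-refl

Null : (ℕ → ℚ) → Set
Null u = ∀ ε → 0ℚ < ε → Eventually λ n → ∣ u n ∣ < ε

Bounded : (ℕ → ℚ) → Set
Bounded u = ∃[ B ] (0ℚ < B × Eventually λ n → ∣ u n ∣ ≤ B)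

null-≗ : (∀ n → u n ≡ v n) → Null u → Null v
null-≗ eq nu ε 0<ε = ev-map (λ n → subst (λ t → ∣ t ∣ < ε) (eq n)) (nu ε 0<ε)

null-0 : Null (λ _ → 0ℚ)
null-0 ε 0<ε = ev-all λ _ → 0<ε

null-suc : Null u → Null (λ n → u (suc n))
null-suc nu ε 0<ε = ev-suc (nu ε 0<ε)

null-+ : Null u → Null v → Null (λ n → u n + v n)
null-+ {u} {v} nu nv ε 0<ε = ev-map₂
  (λ n hu hv → ℚ.≤-<-trans (ℚ.∣p+q∣≤∣p∣+∣q∣ (u n) (v n))
    (subst (∣ u n ∣ + ∣ v n ∣ <_) (halves ε) (ℚ.+-mono-< hu hv)))
  (nu (½ * ε) (half 0<ε)) (nv (½ * ε) (half 0<ε))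

null-neg : Null u → Null (λ n → - u n)
null-neg {u} nu ε 0<ε = ev-map (λ n → subst (_< ε) (sym (ℚ.∣-p∣≡∣p∣ (u n)))) (nu ε 0<ε)

null-* : Bounded u → Null v → Null (λ n → u n * v n)
null-* {u} {v} (B , 0<B , hu) nv ε 0<ε =
  let δ , 0<δ , hδ = shrink B ε 0<B 0<ε
  in ev-map₂ (λ n → hδ (u n) (v n)) hu (nv δ 0<δ)

const-bounded : ∀ q → Bounded (λ _ → q)
const-bounded q = cauchy⇒bounded (const-cauchy q)

cauchy-suc : IsCauchy u → Null (λ n → u (suc n) - u n)
cauchy-suc cu ε 0<ε =
  let N , h = cu ε 0<ε
  in N , λ n N≤n → h (suc n) n (ℕ.m≤n⇒m≤1+n N≤n) N≤n

bounded-~ : Bounded v → Null (λ n → u n - v n) → Bounded u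
bounded-~ {v} {u} (B , 0<B , hv) nu = 1ℚ + B , 0<+ 0<1 (ℚ.<⇒≤ 0<B)
  , ev-map₂ (λ n hv hu → subst (λ t → ∣ t ∣ ≤ 1ℚ + B) (+-cancel (u n) (v n))
      (ℚ.≤-trans (ℚ.∣p+q∣≤∣p∣+∣q∣ (u n - v n) (v n)) (ℚ.+-mono-≤ (ℚ.<⇒≤ hu) hv)))
      hv (nu 1ℚ 0<1)

null-~-* : ∀ {u u′ v v′ : ℕ → ℚ} → Bounded u → Bounded v′ →
           Null (λ n → u n - u′ n) → Null (λ n → v n - v′ n) →
           Null (λ n → u n * v n - u′ n * v′ n)
null-~-* {u} {u′} {v} {v′} bu bv′ nu nv =
  null-≗ (λ n → regroup (u n) (u′ n) (v n) (v′ n)) (null-+ (null-* bu nv) (null-* bv′ nu))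
  where
  open +-*-Solver
  regroup : ∀ a a′ b b′ → a * (b - b′) + b′ * (a - a′) ≡ a * b - a′ * b′
  regroup = solve 4 (λ a a′ b b′ →
    a :* (b :- b′) :+ b′ :* (a :- a′) := a :* b :- a′ :* b′) refl

-- The bound c is uniform so that positivity survives a null perturbation; along a Cauchy sequence
-- this says that the limit is positive.
EventuallyPositive : (ℕ → ℚ) → Set
EventuallyPositive u = ∃[ c ] (0ℚ < c × Eventually λ n → c ≤ u n)

half-lower : ε ≤ x → x - y < ½ * ε → ½ * ε ≤ y
half-lower {ε} {x} {y} ε≤x x-y<½ε =
  ≤-gap (0≤+ (gap-≤ ε≤x) (ℚ.<⇒≤ (gap-< x-y<½ε))) (eqn x y (½ * ε) ε (sym (halves ε)))
  where
  open +-*-Solver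
  eqn : ∀ x y h e → e ≡ h + h → y ≡ h + ((x - e) + (h - (x - y)))
  eqn x y h e refl = solve 3 (λ x y h → y := h :+ ((x :- (h :+ h)) :+ (h :- (x :- y)))) refl x y h

positive-~ : Null (λ n → v n - u n) → EventuallyPositive u → EventuallyPositive v
positive-~ {v} {u} nu (c , 0<c , h) = ½ * c , half 0<c , ev-map₂
  (λ n c≤u v~u → half-lower c≤u (subst (_< ½ * c) (neg-minus (v n) (u n)) (∣∣<⇒-< v~u)))
  h (nu (½ * c) (half 0<c))

module Classical (em : ExcludedMiddle 0ℓ) where

  ¬¬-elim : {A : Set} → ¬ ¬ A → A
  ¬¬-elim = em⇒dne em

  -- If u is not null, some ε is reached by ∣ u n ∣ at arbitrarily late n. Past the point where
  -- terms differ by less than ε / 2, one such term fixes the sign of all the others and leaves them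
  -- at distance at least ε / 2 from 0.
  cauchy-trichotomy : IsCauchy u →
    Null u ⊎ EventuallyPositive u ⊎ EventuallyPositive (λ n → - u n)
  cauchy-trichotomy {u} cu with em {∃[ ε ] (0ℚ < ε × ¬ Eventually λ n → ∣ u n ∣ < ε)}
  ... | no ¬∃ = inj₁ λ ε 0<ε → ¬¬-elim λ ¬ev → ¬∃ (ε , 0<ε , ¬ev)
  ... | yes (ε , 0<ε , ¬ev) with cu (½ * ε) (half 0<ε)
  ...   | N , close with em {∃[ n ] (N ℕ.≤ n × ε ≤ ∣ u n ∣)}
  ...     | no ¬∃ = contradiction
    (N , λ n N≤n → ℚ.≰⇒> λ ε≤ → ¬∃ (n , N≤n , ε≤)) ¬ev
  ...     | yes (n , N≤n , ε≤) with ℚ.∣p∣≡p∨∣p∣≡-p (u n)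
  ...       | inj₁ eq = inj₂ (inj₁ (½ * ε , half 0<ε , N , λ m N≤m →
    half-lower (subst (ε ≤_) eq ε≤) (∣∣<⇒< (close n m N≤n N≤m))))
  ...       | inj₂ eq = inj₂ (inj₂ (½ * ε , half 0<ε , N , λ m N≤m →
    half-lower (subst (ε ≤_) eq ε≤)
      (subst (_< ½ * ε) (flip (u n) (u m)) (∣∣<⇒< (close m n N≤m N≤n)))))
    where
    open +-*-Solver
    flip : ∀ a b → b - a ≡ - a - - b
    flip = solve 2 (λ a b → b :- a := :- a :- :- b) refl

-- Linear forms.  A coefficient vector a is paired with a sequence u; taking u to
-- be the powers of x gives the value of the polynomial a at x, and taking
-- u to be (s (n + i))ᵢ gives the value of the operator a.

⟨_,_⟩ : Vector ℚ k → (ℕ → ℚ) → ℚ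
⟨ a , u ⟩ = ℚ-Sum.sum λ i → a i * u (toℕ i)

⟨⟩-cong : (a : Vector ℚ k) → (∀ i → u i ≡ v i) → ⟨ a , u ⟩ ≡ ⟨ a , v ⟩
⟨⟩-cong a eq = sum-cong-≗ λ i → cong (a i *_) (eq (toℕ i))

⟨⟩-* : ∀ (a : Vector ℚ k) u x → ⟨ a , (λ i → x * u i) ⟩ ≡ x * ⟨ a , u ⟩
⟨⟩-* a u x = trans
  (sum-cong-≗ λ i → swap (a i) x (u (toℕ i)))
  (sym (*-distribˡ-sum x λ i → a i * u (toℕ i)))

⟨⟩-zero : (a : Vector ℚ k) → (∀ i → u i ≡ 0ℚ) → ⟨ a , u ⟩ ≡ 0ℚ
⟨⟩-zero {zero}          a u≡0 = refl
⟨⟩-zero {suc k} {u = u} a u≡0 = cong₂ _+_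
  (trans (cong (a zero *_) (u≡0 0)) (ℚ.*-zeroʳ (a zero)))
  (⟨⟩-zero (λ i → a (suc i)) (λ i → u≡0 (suc i)))

*-⟨⟩ : ∀ x (a : Vector ℚ k) u → ⟨ (λ i → x * a i) , u ⟩ ≡ x * ⟨ a , u ⟩
*-⟨⟩ x a u = trans
  (sum-cong-≗ λ i → ℚ.*-assoc x (a i) (u (toℕ i)))
  (sym (*-distribˡ-sum x λ i → a i * u (toℕ i)))

⟨⟩-- : ∀ (a b : Vector ℚ k) u → ⟨ (λ i → a i - b i) , u ⟩ ≡ ⟨ a , u ⟩ - ⟨ b , u ⟩
⟨⟩-- {zero}  a b u = refl
⟨⟩-- {suc k} a b u = trans
  (cong (((a zero - b zero) * u 0) +_) (⟨⟩-- (λ i → a (suc i)) (λ i → b (suc i)) (λ i → u (suc i))))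
  (regroup (a zero) (b zero) (u 0) _ _)
  where
  open +-*-Solver
  regroup : ∀ a b c d e → (a - b) * c + (d - e) ≡ (a * c + d) - (b * c + e)
  regroup = solve 5 (λ a b c d e →
    (a :- b) :* c :+ (d :- e) := (a :* c :+ d) :- (b :* c :+ e)) refl

neg-⟨⟩ : ∀ (a : Vector ℚ k) u → ⟨ (λ i → - a i) , u ⟩ ≡ - ⟨ a , u ⟩
neg-⟨⟩ a u = trans
  (sum-cong-≗ λ i → cong (_* u (toℕ i)) (minus (a i)))
  (trans (*-⟨⟩ (- 1ℚ) a u) (sym (minus _)))
  where
  open +-*-Solver
  minus : ∀ x → - x ≡ - 1ℚ * x
  minus = solve 1 (λ x → :- x := con (- 1ℚ) :* x) refl

⟨⟩-init : ∀ (a : Vector ℚ (suc k)) u → a (fromℕ k) ≡ 0ℚ →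
  ⟨ a , u ⟩ ≡ ⟨ (λ i → a (inject₁ i)) , u ⟩
⟨⟩-init {zero}  a u a≡0 = trans (ℚ.+-identityʳ _) (trans (cong (_* u 0) a≡0) (ℚ.*-zeroˡ (u 0)))
⟨⟩-init {suc k} a u a≡0 = cong (a zero * u 0 +_)
  (⟨⟩-init (λ i → a (suc i)) (λ i → u (suc i)) a≡0)

IsMonic : Vector ℚ (suc k) → Set
IsMonic {k} f = f (fromℕ k) ≡ 1ℚ

-- Polynomial division b = c + f g, where the product f g is given by its pairing
-- with an arbitrary sequence u.

division : (f : Vector ℚ (suc k)) → IsMonic f → (b : Vector ℚ m) →
  ∃[ c ] ∃[ g ] (∀ u → ⟨ b , u ⟩ ≡
    ⟨_,_⟩ {k} c u + ⟨_,_⟩ {m} g (λ l → ⟨ f , (λ i → u (l ℕ.+ i)) ⟩))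
division {k} {zero}  f monic b = (λ _ → 0ℚ) , b , λ u → sym (trans
  (cong (_+ 0ℚ) (trans (*-⟨⟩ {k} 0ℚ (λ _ → 0ℚ) u) (ℚ.*-zeroˡ (⟨_,_⟩ {k} (λ _ → 0ℚ) u)))) refl)
-- Horner's scheme: write b = b₀ + X b′ and divide b′. Then b₀ + X c may have degree k; its top
-- coefficient t is removed by subtracting t f, and t becomes the constant term of the new quotient
-- t + X g.
division {k} {suc m} f monic b with division f monic (λ i → b (suc i))
... | c , g , eq = c″ , (λ { zero → t ; (suc i) → g i }) , λ u →
  let u′ = λ i → u (suc i) in begin
    b zero * u 0 + ⟨ (λ i → b (suc i)) , u′ ⟩
      ≡⟨ cong (b zero * u 0 +_) (eq u′) ⟩
    b zero * u 0 + (⟨ c , u′ ⟩ + G u)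
      ≡⟨ sym (ℚ.+-assoc (b zero * u 0) ⟨ c , u′ ⟩ (G u)) ⟩
    ⟨ c′ , u ⟩ + G u
      ≡⟨ regroup ⟨ c′ , u ⟩ (G u) t ⟨ f , u ⟩ ⟩
    (⟨ c′ , u ⟩ - t * ⟨ f , u ⟩) + (t * ⟨ f , u ⟩ + G u)
      ≡⟨ cong (_+ (t * ⟨ f , u ⟩ + G u)) (sym (split u)) ⟩
    ⟨ c″ , u ⟩ + (t * ⟨ f , u ⟩ + G u) ∎
  where
  open ≡-Reasoning
  c′ : Vector ℚ (suc k)
  c′ zero    = b zero
  c′ (suc i) = c i
  t : ℚ
  t = c′ (fromℕ k)
  c″ : Vector ℚ k
  c″ i = c′ (inject₁ i) - t * f (inject₁ i)
  G : (ℕ → ℚ) → ℚ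
  G u = ⟨ g , (λ l → ⟨ f , (λ i → u (suc (l ℕ.+ i))) ⟩) ⟩
  top : t - t * f (fromℕ k) ≡ 0ℚ
  top = trans (cong (λ z → t - t * z) monic)
    (trans (cong (λ z → t - z) (ℚ.*-identityʳ t)) (ℚ.+-inverseʳ t))
  split : ∀ u → ⟨ c″ , u ⟩ ≡ ⟨ c′ , u ⟩ - t * ⟨ f , u ⟩
  split u = trans (sym (⟨⟩-init (λ i → c′ i - t * f i) u top))
    (trans (⟨⟩-- c′ (λ i → t * f i) u) (cong (λ z → ⟨ c′ , u ⟩ - z) (*-⟨⟩ t f u)))
  regroup : ∀ a b t f → a + b ≡ (a - t * f) + (t * f + b)
  regroup = solve 4 (λ a b t f → a :+ b := (a :- t :* f) :+ (t :* f :+ b)) refl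
    where open +-*-Solver

-- Polynomials evaluated along Cauchy sequences

evalAlong : Vector ℚ k → (ℕ → ℚ) → ℕ → ℚ
evalAlong a u n = ⟨ a , u n ^_ ⟩

eval-* : (g : Vector ℚ m) (f : Vector ℚ k) →
  ⟨ g , (λ l → ⟨ f , (λ i → x ^ (l ℕ.+ i)) ⟩) ⟩ ≡ ⟨ f , x ^_ ⟩ * ⟨ g , x ^_ ⟩
eval-* {x = x} g f = trans
  (⟨⟩-cong g λ l → trans
    (trans (⟨⟩-cong f (λ i → ^-homo-* x l i)) (⟨⟩-* f (x ^_) (x ^ l)))
    (ℚ.*-comm (x ^ l) ⟨ f , x ^_ ⟩))
  (⟨⟩-* g (x ^_) ⟨ f , x ^_ ⟩)

⟨⟩-cauchy : (a : Vector ℚ k) (w : ℕ → ℕ → ℚ) → (∀ i → IsCauchy (λ n → w n i)) →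
  IsCauchy (λ n → ⟨ a , w n ⟩)
⟨⟩-cauchy {zero}  a w cw = const-cauchy 0ℚ
⟨⟩-cauchy {suc k} a w cw = +-cauchy
  {λ n → a zero * w n 0} {λ n → ⟨ (λ i → a (suc i)) , (λ i → w n (suc i)) ⟩}
  (*-cauchy {λ _ → a zero} {λ n → w n 0} (const-cauchy (a zero)) (cw 0))
  (⟨⟩-cauchy (λ i → a (suc i)) (λ n i → w n (suc i)) (λ i → cw (suc i)))

^-cauchy : IsCauchy u → ∀ i → IsCauchy (λ n → u n ^ i)
^-cauchy     cu zero    = const-cauchy 1ℚ
^-cauchy {u} cu (suc i) = *-cauchy {u} {λ n → u n ^ i} cu (^-cauchy {u} cu i)

eval-cauchy : (a : Vector ℚ k) → IsCauchy u → IsCauchy (evalAlong a u)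
eval-cauchy {u = u} a cu = ⟨⟩-cauchy a (λ n → u n ^_) (^-cauchy {u} cu)

⟨⟩-null : (a : Vector ℚ k) (v w : ℕ → ℕ → ℚ) → (∀ i → Null (λ n → v n i - w n i)) →
  Null (λ n → ⟨ a , v n ⟩ - ⟨ a , w n ⟩)
⟨⟩-null {zero}  a v w h = null-0
⟨⟩-null {suc k} a v w h = null-≗
  (λ n → regroup (a zero) (v n 0) (w n 0) _ _)
  (null-+ (null-* (const-bounded (a zero)) (h 0))
          (⟨⟩-null (λ i → a (suc i)) (λ n i → v n (suc i)) (λ n i → w n (suc i)) (λ i → h (suc i))))
  where
  open +-*-Solver
  regroup : ∀ a b c d e → a * (b - c) + (d - e) ≡ (a * b + d) - (a * c + e)
  regroup = solve 5 (λ a b c d e →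
    a :* (b :- c) :+ (d :- e) := (a :* b :+ d) :- (a :* c :+ e)) refl

seq-^ : ∀ θ i n → seq (θ ℝ-Alg.^ i) n ≡ seq θ n ^ i
seq-^ θ zero    n = refl
seq-^ θ (suc i) n = cong (seq θ n *_) (seq-^ θ i n)

seq-sum : (t : Vector ℝ k) → ∀ n → seq (ℝ-Alg.sum t) n ≡ ℚ-Sum.sum λ i → seq (t i) n
seq-sum {zero}  t n = refl
seq-sum {suc k} t n = cong (seq (t zero) n +_) (seq-sum (λ i → t (suc i)) n)

seq-eval : (a : Vector ℚ (suc k)) → ∀ θ n → seq (eval a θ) n ≡ evalAlong a (seq θ) n
seq-eval a θ n = trans
  (seq-sum (λ i → fromℚ (a i) Defs.* (θ ℝ-Alg.^ toℕ i)) n)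
  (sum-cong-≗ λ i → cong (a i *_) (seq-^ θ (toℕ i) n))

eval≈0⇒null : (a : Vector ℚ (suc k)) → ∀ θ → eval a θ ≈ 0ℝ → Null (evalAlong a (seq θ))
eval≈0⇒null a θ = null-≗ λ n → trans (ℚ.+-identityʳ _) (seq-eval a θ n)

null⇒eval≈0 : (a : Vector ℚ (suc k)) → ∀ θ → Null (evalAlong a (seq θ)) → eval a θ ≈ 0ℝ
null⇒eval≈0 a θ = null-≗ λ n → trans (sym (seq-eval a θ n)) (sym (ℚ.+-identityʳ _))

-- Roots and minimal polynomials

module Algebraic (em : ExcludedMiddle 0ℓ) (θ : ℝ) where

  Root : Vector ℚ k → Set
  Root a = Null (evalAlong a (seq θ))

  -- This covers both cases for θ: for a single j it is the minimality of a minimal polynomial of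
  -- degree j, and for all j it is transcendence.
  NoRootBelow : ℕ → Set
  NoRootBelow j = ∀ m → m ℕ.< j → (b : Vector ℚ (suc m)) → b (fromℕ m) ≢ 0ℚ → ¬ Root b

  HasMinimalPolynomial : Set
  HasMinimalPolynomial = ∃[ k ] Σ (Vector ℚ (suc k)) λ f → IsMinimalPolynomial f θ

  -- A nonzero top coefficient would give a root polynomial of forbidden degree, so the coefficients
  -- are stripped from the top one by one. That c = 0 is expressed by its pairings, since c is later
  -- paired with terms of R and not only with powers of θ.
  root⇒zero : ∀ k → NoRootBelow k → (c : Vector ℚ k) → Root c → ∀ u → ⟨ c , u ⟩ ≡ 0ℚ
  root⇒zero zero    none c root u = refl
  root⇒zero (suc k) none c root u with c (fromℕ k) ℚ.≟ 0ℚ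
  ... | no  ≢0 = contradiction root (none k (ℕ.n<1+n k) c ≢0)
  ... | yes ≡0 = trans (⟨⟩-init c u ≡0)
    (root⇒zero k (λ m m<k → none m (ℕ.m<n⇒m<1+n m<k)) (λ i → c (inject₁ i))
      (null-≗ (λ n → ⟨⟩-init c (seq θ n ^_) ≡0) root) u)

  -- The remainder c = b - f g vanishes at θ and has degree below k, so it is zero. The division
  -- identity is used twice: at powers of θ to see that c has the root, and at arbitrary u for the
  -- conclusion.
  root⇒multiple : (f : Vector ℚ (suc k)) → IsMinimalPolynomial f θ →
    (b : Vector ℚ m) → Root b →
    ∃[ g ] (∀ u → ⟨ b , u ⟩ ≡ ⟨_,_⟩ {m} g (λ l → ⟨ f , (λ i → u (l ℕ.+ i)) ⟩))
  root⇒multiple {k} {m} f f-min b b-root with division f (IsMinimalPolynomial.monic f-min) b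
  ... | c , g , eq = g , λ u → trans (eq u)
    (trans (cong (_+ ⟨ g , (λ l → ⟨ f , (λ i → u (l ℕ.+ i)) ⟩) ⟩) (root⇒zero k none c c-root u))
           (ℚ.+-identityˡ _))
    where
    open IsMinimalPolynomial f-min
    none : NoRootBelow k
    none m m<k b ≢0 b-root = ℕ.<⇒≱ m<k (minimal m b ≢0 (null⇒eval≈0 b θ b-root))
    F G : ℕ → ℚ
    F = evalAlong f (seq θ)
    G = evalAlong g (seq θ)
    rearrange : ∀ {b} c g f → b ≡ c + f * g → b + - (g * f) ≡ c
    rearrange c g f refl = solve 3 (λ c g f → (c :+ f :* g) :+ :- (g :* f) := c) refl c g f
      where open +-*-Solver
    remainder : ∀ n → evalAlong b (seq θ) n + - (G n * F n) ≡ evalAlong c (seq θ) n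
    remainder n = rearrange (evalAlong c (seq θ) n) (G n) (F n)
      (trans (eq (seq θ n ^_)) (cong (⟨ c , seq θ n ^_ ⟩ +_) (eval-* g f)))
    GF-null : Null λ n → G n * F n
    GF-null = null-* {G} {F} (cauchy⇒bounded {G} (eval-cauchy {u = seq θ} g (cauchy θ)))
      (eval≈0⇒null f θ root)
    c-root : Root c
    c-root = null-≗ remainder (null-+ b-root (null-neg GF-null))

  makeMonic : NoRootBelow k → (b : Vector ℚ (suc k)) → b (fromℕ k) ≢ 0ℚ → Root b →
    HasMinimalPolynomial
  makeMonic {k} none b ≢0 root with inverse (b (fromℕ k)) ≢0
  ... | y , y*b≡1 = k , (λ i → y * b i) , record
    { monic   = y*b≡1
    ; root    = null⇒eval≈0 (λ i → y * b i) θ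
        (null-≗ (λ n → sym (*-⟨⟩ y b (seq θ n ^_))) (null-* (const-bounded y) root))
    ; minimal = λ m c ≢0 c-root → ℕ.≮⇒≥ λ m<k → none m m<k c ≢0 (eval≈0⇒null c θ c-root)
    }

  -- Induction on the degree: a root polynomial with none of smaller degree, divided by its leading
  -- coefficient, would be a minimal polynomial.
  transcendental : ¬ HasMinimalPolynomial → ∀ k → NoRootBelow k
  transcendental ¬min (suc k) m m<1+k b ≢0 root with ℕ.m<1+n⇒m<n∨m≡n m<1+k
  ... | inj₁ m<k  = transcendental ¬min k m m<k b ≢0 root
  ... | inj₂ refl = ¬min (makeMonic (transcendental ¬min k) b ≢0 root)

  -- Without a minimal polynomial b is zero. Otherwise b = f g, and the pairing is a combination of
  -- shifts of the recurrence of f, each of which is 0.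
  root⇒vanishes : (s : ℕ → ℚ) →
    (∀ k (f : Vector ℚ (suc k)) → IsMinimalPolynomial f θ →
      ∀ n → ⟨ f , (λ i → s (n ℕ.+ i)) ⟩ ≡ 0ℚ) →
    (b : Vector ℚ m) → Root b → ∀ n → ⟨ b , (λ i → s (n ℕ.+ i)) ⟩ ≡ 0ℚ
  root⇒vanishes {m} s recurrence b b-root n = by-cases (em {HasMinimalPolynomial})
    where
    sₙ : ℕ → ℚ
    sₙ i = s (n ℕ.+ i)
    by-cases : Dec HasMinimalPolynomial → ⟨ b , sₙ ⟩ ≡ 0ℚ
    by-cases (no ¬min) = root⇒zero m (transcendental ¬min m) b b-root sₙ
    by-cases (yes (k , f , f-min)) =
      let g , eq = root⇒multiple f f-min b b-root
      in trans (eq sₙ) (⟨⟩-zero g shifted)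
      where
      shifted : ∀ l → ⟨ f , (λ i → sₙ (l ℕ.+ i)) ⟩ ≡ 0ℚ
      shifted l = trans (⟨⟩-cong f λ i → cong s (sym (ℕ.+-assoc n l i)))
        (recurrence k f f-min (n ℕ.+ l))

-- The values of operators along a strictly increasing sequence

module Operators (s : ℕ → ℚ) (0≤s₀ : 0ℚ ≤ s 0) (s-increasing : ∀ n → s n < s (suc n)) where

  value : Vector ℚ k → ℕ → ℚ
  value a n = ⟨ a , (λ i → s (n ℕ.+ i)) ⟩

  value-suc : (a : Vector ℚ (suc k)) → ∀ n →
    value a n ≡ a zero * s n + value (λ i → a (suc i)) (suc n)
  value-suc a n = cong₂ _+_
    (cong (λ t → a zero * s t) (ℕ.+-identityʳ n))
    (⟨⟩-cong (λ i → a (suc i)) λ i → cong s (ℕ.+-suc n i))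

  0≤s : ∀ n → 0ℚ ≤ s n
  0≤s zero    = 0≤s₀
  0≤s (suc n) = ℚ.≤-trans (0≤s n) (ℚ.<⇒≤ (s-increasing n))

  0<s-suc : ∀ n → 0ℚ < s (suc n)
  0<s-suc n = ℚ.≤-<-trans (0≤s n) (s-increasing n)

  0<s : Eventually λ n → 0ℚ < s n
  0<s = 1 , λ { (suc n) _ → 0<s-suc n }

  s-+ : ∀ n j → s n ≤ s (n ℕ.+ j)
  s-+ n zero    = ℚ.≤-reflexive (cong s (sym (ℕ.+-identityʳ n)))
  s-+ n (suc j) = ℚ.≤-trans (s-+ n j)
    (subst (λ t → s (n ℕ.+ j) ≤ s t) (sym (ℕ.+-suc n j)) (ℚ.<⇒≤ (s-increasing (n ℕ.+ j))))

  Dominates : (ℕ → ℚ) → Set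
  Dominates u = ∃[ c ] (0ℚ < c × Eventually λ n → c * s n ≤ u n)

  dominates-≗ : (∀ n → u n ≡ v n) → Dominates u → Dominates v
  dominates-≗ eq (c , 0<c , h) = c , 0<c , ev-map (λ n → subst (c * s n ≤_) (eq n)) h

  dominates⇒positive : Dominates u → Eventually λ n → 0ℚ < u n
  dominates⇒positive (c , 0<c , h) =
    ev-map₂ (λ n 0<s h → ℚ.<-≤-trans (0<* 0<c 0<s) h) 0<s h

  -- (S1) with each sign strengthened to a bound by a multiple of `s n`, which is what (S2) is
  -- deduced from.
  Trichotomy : Vector ℚ k → Set
  Trichotomy a = (∀ n → value a n ≡ 0ℚ)
    ⊎ Dominates (value a) ⊎ Dominates (λ n → - value a n)

  -- θ = ∞

  Superexponential : Set
  Superexponential = ∀ j → Eventually λ n → natℚ j * s n ≤ s (suc n)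

  -- The term u (n + 1) is at least c * `s (n + 1)`, hence at least c j * `s n` for any chosen j.
  -- Taking c j > c - q absorbs even a very negative q, and the constant c is kept.
  dominates-step : Superexponential → ∀ q → Dominates u → Dominates λ n → q * s n + u (suc n)
  dominates-step {u} super q (c , 0<c , h) =
    let j , hj = archimedean-* 0<c (c - q)
    in c , 0<c , ev-map₂
      (λ n h growth → ≤-gap
        (0≤+ (0≤+ (gap-≤ h) (0≤* (ℚ.<⇒≤ 0<c) (gap-≤ growth))) (0≤* (gap-≤ (ℚ.<⇒≤ hj)) (0≤s n)))
        (eqn q c (natℚ j) (s n) (s (suc n)) (u (suc n))))
      (ev-suc h) (super j)
    where
    open +-*-Solver
    eqn : ∀ q c j s s′ u → q * s + u ≡
      c * s + ((u - c * s′) + c * (s′ - j * s) + (j * c - (c - q)) * s)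
    eqn = solve 6 (λ q c j s s′ u → q :* s :+ u :=
      c :* s :+ ((u :- c :* s′) :+ c :* (s′ :- j :* s) :+ (j :* c :- (c :- q)) :* s)) refl

  -- The induction splits off the lowest coefficient: a nonzero tail decides the sign whatever that
  -- coefficient is, and if the tail vanishes, the sign of the coefficient itself decides.
  superexponential⇒trichotomy : Superexponential → (a : Vector ℚ k) → Trichotomy a
  superexponential⇒trichotomy {zero}  super a = inj₁ λ _ → refl
  superexponential⇒trichotomy {suc k} super a
    with superexponential⇒trichotomy super (λ i → a (suc i))
  ... | inj₂ (inj₁ pos) = inj₂ (inj₁
    (dominates-≗ (λ n → sym (value-suc a n)) (dominates-step super (a zero) pos)))
  ... | inj₂ (inj₂ neg) = inj₂ (inj₂
    (dominates-≗ (λ n → sym (trans (cong -_ (value-suc a n)) (minus (a zero) (s n) _)))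
      (dominates-step super (- a zero) neg)))
    where
    open +-*-Solver
    minus : ∀ a s v → - (a * s + v) ≡ - a * s + - v
    minus = solve 3 (λ a s v → :- (a :* s :+ v) := :- a :* s :+ :- v) refl
  ... | inj₁ tail≡0 = lead (ℚ.<-cmp (a zero) 0ℚ)
    where
    only : ∀ n → value a n ≡ a zero * s n
    only n = trans (value-suc a n)
      (trans (cong (a zero * s n +_) (tail≡0 (suc n))) (ℚ.+-identityʳ _))
    lead : Tri (a zero < 0ℚ) (a zero ≡ 0ℚ) (0ℚ < a zero) → Trichotomy a
    lead (tri≈ _ ≡0 _) = inj₁ λ n → trans (only n) (trans (cong (_* s n) ≡0) (ℚ.*-zeroˡ (s n)))
    lead (tri> _ _ >0) = inj₂ (inj₁ (a zero , >0 , ev-all λ n → ℚ.≤-reflexive (sym (only n))))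
    lead (tri< <0 _ _) = inj₂ (inj₂ (- a zero , ℚ.neg-antimono-< <0
      , ev-all λ n → ℚ.≤-reflexive (trans (sym (ℚ.neg-distribˡ-* (a zero) (s n)))
                                          (cong -_ (sym (only n))))))

  -- θ finite

  module Quotients (ρ : ℕ → ℚ) (ρ-quotient : ∀ n → ρ (suc n) * s (suc n) ≡ s (suc (suc n)))
                   (θ : ℝ) (ρ~θ : Null λ n → ρ n - seq θ n) where

    -- For n ≥ 1 this is s (n + i) / s n, written as a product of i consecutive quotients so that
    -- its convergence to the i-th power of θ follows factor by factor.
    quotients : ℕ → ℕ → ℚ
    quotients n zero    = 1ℚ
    quotients n (suc i) = ρ n * quotients (suc n) i

    quotients-* : ∀ n i → s (suc n) * quotients (suc n) i ≡ s (suc n ℕ.+ i)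
    quotients-* n zero    = trans (ℚ.*-identityʳ _) (cong s (sym (ℕ.+-identityʳ (suc n))))
    quotients-* n (suc i) = begin
      s (suc n) * (ρ (suc n) * q)   ≡⟨ sym (ℚ.*-assoc (s (suc n)) (ρ (suc n)) q) ⟩
      s (suc n) * ρ (suc n) * q     ≡⟨ cong (_* q) (ℚ.*-comm (s (suc n)) (ρ (suc n))) ⟩
      ρ (suc n) * s (suc n) * q     ≡⟨ cong (_* q) (ρ-quotient n) ⟩
      s (suc (suc n)) * q           ≡⟨ quotients-* (suc n) i ⟩
      s (suc (suc n) ℕ.+ i)         ≡⟨ cong s (sym (ℕ.+-suc (suc n) i)) ⟩
      s (suc n ℕ.+ suc i)           ∎
      where
      open ≡-Reasoning
      q : ℚ
      q = quotients (suc (suc n)) i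

    quotients~powers : ∀ i → Null λ n → quotients n i - seq θ n ^ i
    quotients~powers zero    = null-0
    quotients~powers (suc i) = null-~-* {ρ} {seq θ} {λ n → quotients (suc n) i} {λ n → seq θ n ^ i}
      (bounded-~ {seq θ} {ρ} (cauchy⇒bounded (cauchy θ)) ρ~θ)
      (cauchy⇒bounded {λ n → seq θ n ^ i} θ^i) ρ~θ
      -- The induction hypothesis at n + 1 compares with the approximation of θ at n + 1; the Cauchy
      -- property moves it back to n.
      (null-≗ (λ n → telescope (quotients (suc n) i) (seq θ (suc n) ^ i) (seq θ n ^ i))
        (null-+ (null-suc (quotients~powers i)) (cauchy-suc {λ n → seq θ n ^ i} θ^i)))
      where
      θ^i : IsCauchy λ n → seq θ n ^ i
      θ^i = ^-cauchy {seq θ} (cauchy θ) i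

    -- For n ≥ 1 this is `value a n` divided by `s n`.
    scaled : Vector ℚ k → ℕ → ℚ
    scaled a n = ⟨ a , quotients n ⟩

    scaled-* : ∀ (a : Vector ℚ k) n → s (suc n) * scaled a (suc n) ≡ value a (suc n)
    scaled-* a n = trans (sym (⟨⟩-* a (quotients (suc n)) (s (suc n)))) (⟨⟩-cong a (quotients-* n))

    scaled~eval : (a : Vector ℚ k) → Null λ n → scaled a n - evalAlong a (seq θ) n
    scaled~eval a = ⟨⟩-null a quotients (λ n → seq θ n ^_) quotients~powers

    root⇒scaled-null : (a : Vector ℚ k) → Null (evalAlong a (seq θ)) → Null (scaled a)
    root⇒scaled-null a root = null-≗ (λ n → +-cancel (scaled a n) (evalAlong a (seq θ) n))
      (null-+ (scaled~eval a) root)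

    positive⇒dominates : ∀ {p} → (∀ n → s (suc n) * p (suc n) ≡ u (suc n)) →
      EventuallyPositive p → Dominates u
    positive⇒dominates {p = p} eq (c , 0<c , h) = c , 0<c , ev-pred (ev-map
      (λ n c≤p → subst₂ _≤_ (ℚ.*-comm (s (suc n)) c) (eq n) (*-mono-≤ (0≤s (suc n)) c≤p))
      (ev-suc h))

    quotients⇒trichotomy : ExcludedMiddle 0ℓ → (a : Vector ℚ k) →
      (Null (evalAlong a (seq θ)) → ∀ n → value a n ≡ 0ℚ) → Trichotomy a
    quotients⇒trichotomy em a root⇒0
      with Classical.cauchy-trichotomy em {evalAlong a (seq θ)} (eval-cauchy {u = seq θ} a (cauchy θ))
    ... | inj₁ root = inj₁ (root⇒0 root)
    ... | inj₂ (inj₁ pos) = inj₂ (inj₁ (positive⇒dominates (scaled-* a)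
      (positive-~ {scaled a} {evalAlong a (seq θ)} (scaled~eval a) pos)))
    ... | inj₂ (inj₂ neg) = inj₂ (inj₂ (positive⇒dominates
      (λ n → trans (sym (ℚ.neg-distribʳ-* (s (suc n)) (scaled a (suc n)))) (cong -_ (scaled-* a n)))
      (positive-~ {λ n → - scaled a n} {λ n → - evalAlong a (seq θ) n}
        (null-≗ (λ n → ℚ.neg-distrib-+ (scaled a n) (- evalAlong a (seq θ) n))
          (null-neg (scaled~eval a))) neg)))

  -- Exponential growth and (S2)

  ExponentialGrowth : Set
  ExponentialGrowth = ∃[ δ ] (0ℚ < δ × Eventually λ n → δ * s n + s n ≤ s (suc n))

  -- Bernoulli's inequality for the iterates of s n ↦ s (suc n)
  growth-iterate : ∀ {δ N} → 0ℚ < δ → (∀ n → N ℕ.≤ n → δ * s n + s n ≤ s (suc n)) →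
    ∀ j n → N ℕ.≤ n → natℚ j * δ * s n + s n ≤ s (n ℕ.+ j)
  growth-iterate {δ} 0<δ growth zero n N≤n = ℚ.≤-reflexive
    (trans (zeroˡ δ (s n)) (cong s (sym (ℕ.+-identityʳ n))))
    where
    open +-*-Solver
    zeroˡ : ∀ d x → 0ℚ * d * x + x ≡ x
    zeroˡ = solve 2 (λ d x → con 0ℚ :* d :* x :+ x := x) refl
  growth-iterate {δ} 0<δ growth (suc j) n N≤n =
    subst₂ (λ t i → t * δ * s n + s n ≤ s i) (sym (natℚ-suc j)) (sym (ℕ.+-suc n j))
      -- The increment δ * s (n + j) is only used through its lower bound δ * s n, which gives
      -- growth linear in j.
      (≤-gap (0≤+ (0≤+
          (gap-≤ (growth (n ℕ.+ j) (ℕ.≤-trans N≤n (ℕ.m≤m+n n j))))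
          (gap-≤ (growth-iterate 0<δ growth j n N≤n)))
          (0≤* (ℚ.<⇒≤ 0<δ) (gap-≤ (s-+ n j))))
        (eqn (natℚ j) δ (s n) (s (n ℕ.+ j)) (s (suc (n ℕ.+ j)))))
    where
    open +-*-Solver
    eqn : ∀ j d x x′ x″ → x″ ≡
      ((1ℚ + j) * d * x + x) + ((x″ - (d * x′ + x′)) + (x′ - (j * d * x + x)) + d * (x′ - x))
    eqn = solve 5 (λ j d x x′ x″ → x″ :=
      ((con 1ℚ :+ j) :* d :* x :+ x)
        :+ ((x″ :- (d :* x′ :+ x′)) :+ (x′ :- (j :* d :* x :+ x)) :+ d :* (x′ :- x))) refl

  -- With j c δ > 1, Bernoulli's inequality gives u (n′ + j) ≥ c * s (n′ + j) ≥ (j c δ + c) * s n′ >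
  -- s n′. Taking n′ = n + N′ passes the thresholds of both hypotheses for every n at once.
  dominates⇒overtakes : ExponentialGrowth → Dominates u → ∃[ Δ ] (∀ n → s n < u (n ℕ.+ Δ))
  dominates⇒overtakes {u} (δ , 0<δ , M , growth) (c , 0<c , N , dom) =
    let j , hj = archimedean-* (0<* 0<c 0<δ) 1ℚ in N′ ℕ.+ j , overtakes j hj
    where
    N′ : ℕ
    -- The successor makes `s n′` positive even when `s 0` is 0.
    N′ = suc (M ℕ.⊔ N)
    open +-*-Solver
    eqn : ∀ c j d x x′ y → y ≡
      x + ((((j * (c * d) - 1ℚ) * x + c * x)) + (c * (x′ - (j * d * x + x)) + (y - c * x′)))
    eqn = solve 6 (λ c j d x x′ y → y :=
      x :+ ((((j :* (c :* d) :- con 1ℚ) :* x :+ c :* x))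
        :+ (c :* (x′ :- (j :* d :* x :+ x)) :+ (y :- c :* x′)))) refl
    overtakes : ∀ j → 1ℚ < natℚ j * (c * δ) → ∀ n → s n < u (n ℕ.+ (N′ ℕ.+ j))
    overtakes j hj n = ℚ.≤-<-trans (s-+ n N′)
      (subst (λ t → s (n ℕ.+ N′) < u t) (ℕ.+-assoc n N′ j)
        (<-gap (0<+ (0<+ (0<* (gap-< hj) 0<x) (ℚ.<⇒≤ (0<* 0<c 0<x)))
                 (0≤+ (0≤* (ℚ.<⇒≤ 0<c) (gap-≤ (growth-iterate 0<δ growth j n′ M≤n′)))
                      (gap-≤ (dom (n′ ℕ.+ j) (ℕ.≤-trans N≤n′ (ℕ.m≤m+n n′ j))))))
          (eqn c (natℚ j) δ (s n′) (s (n′ ℕ.+ j)) (u (n′ ℕ.+ j)))))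
      where
      n′ : ℕ
      n′ = n ℕ.+ N′
      M≤n′ : M ℕ.≤ n′
      M≤n′ = ℕ.≤-trans (ℕ.m≤n⇒m≤1+n (ℕ.m≤m⊔n M N)) (ℕ.m≤n+m N′ n)
      N≤n′ : N ℕ.≤ n′
      N≤n′ = ℕ.≤-trans (ℕ.m≤n⇒m≤1+n (ℕ.m≤n⊔m M N)) (ℕ.m≤n+m N′ n)
      0<x : 0ℚ < s n′
      0<x = subst (λ t → 0ℚ < s t) (sym (ℕ.+-suc n (M ℕ.⊔ N))) (0<s-suc (n ℕ.+ (M ℕ.⊔ N)))

  positive⇒overtakes : ExponentialGrowth → (a : Vector ℚ k) → Trichotomy a →
    Eventually (λ n → 0ℚ < value a n) → ∃[ Δ ] (∀ n → s n < value a (n ℕ.+ Δ))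
  positive⇒overtakes growth a (inj₁ ≡0) pos =
    contradiction (ev-map (λ n 0<v → ℚ.<-irrefl (sym (≡0 n)) 0<v) pos) ev-⊥
  positive⇒overtakes growth a (inj₂ (inj₁ dom)) pos = dominates⇒overtakes growth dom
  positive⇒overtakes growth a (inj₂ (inj₂ dom)) pos = contradiction
    (ev-map₂ (λ n 0<v 0<-v → ℚ.<-asym 0<v (subst (_< 0ℚ) (neg-involutive (value a n)) (ℚ.neg-antimono-< 0<-v)))
      pos (dominates⇒positive dom)) ev-⊥

-- Sparse sequences have a limit quotient

module SparseSequence (em : ExcludedMiddle 0ℓ)
  (s : ℕ → ℚ) (0≤s₀ : 0ℚ ≤ s 0) (s-increasing : ∀ n → s n < s (suc n))
  (ρ : ℕ → ℚ) (ρ-quotient : ∀ n → ρ (suc n) * s (suc n) ≡ s (suc (suc n))) where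

  open Operators s 0≤s₀ s-increasing

  -- (S1) and (S2) as they hold for rational coefficients: clearing denominators keeps signs but
  -- rescales the operator, whence the factor d in `overtakes`.
  module Signed
    (signed : ∀ {k} (a : Vector ℚ (suc k)) → (∀ n → value a n ≡ 0ℚ)
      ⊎ Eventually (λ n → 0ℚ < value a n) ⊎ Eventually (λ n → value a n < 0ℚ))
    (overtakes : ∀ {k} (a : Vector ℚ (suc k)) → Eventually (λ n → 0ℚ < value a n) →
      ∃[ Δ ] ∃[ d ] (0ℚ < d × (∀ n → d * s n < value a (n ℕ.+ Δ)))) where

    linear : ℚ → ℚ → Vector ℚ 2
    linear x y zero       = x
    linear x y (suc zero) = y

    value-linear : ∀ x y n → value (linear x y) n ≡ x * s n + y * s (suc n)
    value-linear x y n = trans (value-suc (linear x y) n) (cong (x * s n +_)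
      (trans (ℚ.+-identityʳ _) (cong (λ t → y * s t) (ℕ.+-identityʳ (suc n)))))

    ρ-lower : ∀ q n → q * s (suc n) ≤ s (suc (suc n)) → q ≤ ρ (suc n)
    ρ-lower q n h = *-cancel-≤ (0<s-suc n) (subst (q * s (suc n) ≤_) (sym (ρ-quotient n)) h)

    ρ-upper : ∀ q n → s (suc (suc n)) ≤ q * s (suc n) → ρ (suc n) ≤ q
    ρ-upper q n h = *-cancel-≤ (0<s-suc n) (subst (_≤ q * s (suc n)) (sym (ρ-quotient n)) h)

    compare : ∀ q → Eventually (λ n → ρ n ≤ q) ⊎ Eventually (λ n → q ≤ ρ n)
    compare q = by-sign (signed (linear (- q) 1ℚ))
      where
      open +-*-Solver
      eqn : ∀ q x y → y ≡ q * x + (- q * x + 1ℚ * y)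
      eqn = solve 3 (λ q x y → y := q :* x :+ (:- q :* x :+ con 1ℚ :* y)) refl
      eqn′ : ∀ q x y → q * x ≡ y + - (- q * x + 1ℚ * y)
      eqn′ = solve 3 (λ q x y → q :* x := y :+ :- (:- q :* x :+ con 1ℚ :* y)) refl
      v≡ : ∀ n → value (linear (- q) 1ℚ) n ≡ - q * s n + 1ℚ * s (suc n)
      v≡ = value-linear (- q) 1ℚ
      above : ∀ n → 0ℚ ≤ value (linear (- q) 1ℚ) (suc n) → q ≤ ρ (suc n)
      above n h = ρ-lower q n
        (≤-gap (subst (0ℚ ≤_) (v≡ (suc n)) h) (eqn q (s (suc n)) (s (suc (suc n)))))
      below : ∀ n → value (linear (- q) 1ℚ) (suc n) < 0ℚ → ρ (suc n) ≤ q
      below n h = ρ-upper q n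
        (≤-gap (ℚ.<⇒≤ (ℚ.neg-antimono-< (subst (_< 0ℚ) (v≡ (suc n)) h)))
               (eqn′ q (s (suc n)) (s (suc (suc n)))))
      by-sign : _ → Eventually (λ n → ρ n ≤ q) ⊎ Eventually (λ n → q ≤ ρ n)
      by-sign (inj₁ ≡0)        = inj₂ (ev-pred (ev-all λ n → above n (ℚ.≤-reflexive (sym (≡0 (suc n))))))
      by-sign (inj₂ (inj₁ >0)) = inj₂ (ev-pred (ev-map (λ n h → above n (ℚ.<⇒≤ h)) (ev-suc >0)))
      by-sign (inj₂ (inj₂ <0)) = inj₁ (ev-pred (ev-map below (ev-suc <0)))

    EventuallyBelow : ℕ → Set
    EventuallyBelow j = Eventually λ n → ρ n ≤ natℚ j

    unbounded : ¬ ∃ EventuallyBelow → ∀ q → Eventually λ n → q ≤ ρ n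
    unbounded ¬bounded q =
      let j , q<j = archimedean q in by-cases j q<j (compare (natℚ j))
      where
      by-cases : ∀ j → q < natℚ j → EventuallyBelow j ⊎ Eventually (λ n → natℚ j ≤ ρ n) →
        Eventually λ n → q ≤ ρ n
      by-cases j q<j (inj₁ h) = contradiction (j , h) ¬bounded
      by-cases j q<j (inj₂ h) = ev-map (λ n → ℚ.≤-trans (ℚ.<⇒≤ q<j)) h

    module BoundedRatio (j : ℕ) (ρ≤j : EventuallyBelow j) where

      0≤ρ : Eventually λ n → 0ℚ ≤ ρ n
      0≤ρ = ev-pred (ev-all λ n → ρ-lower 0ℚ n
        (subst (_≤ s (suc (suc n))) (sym (ℚ.*-zeroˡ (s (suc n)))) (0≤s (suc (suc n)))))

      Bracketed : ℚ → Set
      Bracketed ε = ∃[ q ] Eventually λ n → q ≤ ρ n × ρ n ≤ q + ε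

      -- Walks down the multiples of ε: comparison with the next lower one either closes the bracket
      -- or lowers the upper bound. The walk stops at 0 because the quotients are nonnegative.
      descend : 0ℚ < ε → ∀ i → Eventually (λ n → ρ n ≤ natℚ i * ε) → Bracketed ε
      descend {ε} 0<ε zero h = 0ℚ , ev-map₂
        (λ n h 0≤ρ → 0≤ρ , ℚ.≤-trans h (ℚ.≤-trans (ℚ.≤-reflexive (ℚ.*-zeroˡ ε))
           (subst (0ℚ ≤_) (sym (ℚ.+-identityˡ ε)) (ℚ.<⇒≤ 0<ε)))) h 0≤ρ
      descend {ε} 0<ε (suc i) h = by-cases (compare (natℚ i * ε))
        where
        open +-*-Solver
        distrib : ∀ i e → (1ℚ + i) * e ≡ i * e + e
        distrib = solve 2 (λ i e → (con 1ℚ :+ i) :* e := i :* e :+ e) refl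
        step : natℚ (suc i) * ε ≡ natℚ i * ε + ε
        step = trans (cong (_* ε) (natℚ-suc i)) (distrib (natℚ i) ε)
        by-cases : _ → Bracketed ε
        by-cases (inj₁ below) = descend 0<ε i below
        by-cases (inj₂ above) = natℚ i * ε
          , ev-map₂ (λ n l u → l , subst (ρ n ≤_) step u) above h

      bracket : 0ℚ < ε → Bracketed ε
      bracket {ε} 0<ε = let i , hi = archimedean-* 0<ε (natℚ j) in
        descend 0<ε i (ev-map (λ n h → ℚ.≤-trans h (ℚ.<⇒≤ hi)) ρ≤j)

      bracket⇒close : ∀ {q x y} → q ≤ x → y ≤ q + ε → y - x ≤ ε
      bracket⇒close {ε} {q} {x} {y} q≤x y≤q+ε =
        ≤-gap (0≤+ (gap-≤ q≤x) (gap-≤ y≤q+ε)) (eqn q x y ε)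
        where
        open +-*-Solver
        eqn : ∀ q x y e → e ≡ (y - x) + ((x - q) + ((q + e) - y))
        eqn = solve 4 (λ q x y e → e := (y :- x) :+ ((x :- q) :+ ((q :+ e) :- y))) refl

      ρ-cauchy : IsCauchy ρ
      ρ-cauchy ε 0<ε =
        -- Halving ε turns the weak inequalities of the bracket into the strict one required.
        let q , N , h = bracket (half 0<ε)
        in N , λ m n N≤m N≤n →
          let l , u = h m N≤m
              l′ , u′ = h n N≤n
          in ℚ.≤-<-trans
            (∣∣≤-intro (bracket⇒close l′ u)
              (subst (_≤ ½ * ε) (sym (neg-minus (ρ m) (ρ n))) (bracket⇒close l u′)))
            ½ε<ε
        where
        ½ε<ε : ½ * ε < ε
        ½ε<ε = <-gap (half 0<ε) (sym (halves ε))

      -- Bounded quotients let a shift by Δ cost only a constant factor. This brings the two indices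
      -- in (S2) together.
      contraction : ∀ Δ → ∃[ c ] (0ℚ < c × Eventually λ n → c * s (n ℕ.+ Δ) ≤ s n)
      contraction zero = 1ℚ , 0<1 , ev-all λ n → ℚ.≤-reflexive
        (trans (ℚ.*-identityˡ _) (cong s (ℕ.+-identityʳ n)))
      contraction (suc Δ) =
        let c , 0<c , h = contraction Δ
            -- The bound j + 1 is inverted instead of j, so that the divisor is visibly positive.
            b , 0<b , bj≡1 = inverse-pos (fromℕ-pos j)
        in b * c , 0<* 0<b 0<c , ev-pred (ev-map₂
          (λ n h ρ≤ → subst (λ t → b * c * s t ≤ s (suc n)) (sym (ℕ.+-suc (suc n) Δ))
            (ℚ.≤-trans
              (subst (_≤ b * s (suc (suc n))) (sym (ℚ.*-assoc b c _)) (*-mono-≤ (ℚ.<⇒≤ 0<b) h))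
              (subst (b * s (suc (suc n)) ≤_)
                (trans (sym (ℚ.*-assoc b (natℚ (suc j)) (s (suc n))))
                  (trans (cong (_* s (suc n)) bj≡1) (ℚ.*-identityˡ _)))
                (*-mono-≤ (ℚ.<⇒≤ 0<b) (step n ρ≤)))))
          (ev-suc (ev-suc h)) (ev-suc ρ≤j))
        where
        fromℕ-pos : ∀ j → 0ℚ < natℚ (suc j)
        fromℕ-pos j = ℚ.positive⁻¹ (natℚ (suc j))
        step : ∀ n → ρ (suc n) ≤ natℚ j → s (suc (suc n)) ≤ natℚ (suc j) * s (suc n)
        step n ρ≤ = ≤-gap (0≤+ (0≤* (gap-≤ ρ≤) (0≤s (suc n))) (0≤s (suc n)))
          (eqn (ρ (suc n)) (natℚ j) (s (suc n)) _ _ (natℚ-suc j) (sym (ρ-quotient n)))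
          where
          open +-*-Solver
          eqn : ∀ r j x y J → J ≡ 1ℚ + j → y ≡ r * x → J * x ≡ y + ((j - r) * x + x)
          eqn r j x y J refl refl = solve 3 (λ r j x →
            (con 1ℚ :+ j) :* x := r :* x :+ ((j :- r) :* x :+ x)) refl r j x

      -- For m = n + Δ, (S2) for σ - 1 gives s (m + 1) - s m > d * s n, and `contraction` gives s n
      -- ≥ c * s m. Hence δ = d c.
      1<ρ : ∃[ δ ] (0ℚ < δ × Eventually λ n → 1ℚ + δ ≤ ρ n)
      1<ρ =
        let Δ , d , 0<d , h = overtakes (linear (- 1ℚ) 1ℚ) (ev-all increasing)
            c , 0<c , h′ = contraction Δ
        in d * c , 0<* 0<d 0<c , ev-pred (ev-map (λ n → ρ-lower (1ℚ + d * c) n)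
             (ev-suc (ev-unshift {λ n → (1ℚ + d * c) * s n ≤ s (suc n)} Δ
               (ev-map (λ n → separated d c n (n ℕ.+ Δ) 0<d (h n)) h′))))
        where
        open +-*-Solver
        increasing : ∀ n → 0ℚ < value (linear (- 1ℚ) 1ℚ) n
        increasing n = subst (0ℚ <_)
          (trans (difference (s n) (s (suc n))) (sym (value-linear (- 1ℚ) 1ℚ n)))
          (gap-< (s-increasing n))
          where
          difference : ∀ x y → y - x ≡ - 1ℚ * x + 1ℚ * y
          difference = solve 2 (λ x y → y :- x := con (- 1ℚ) :* x :+ con 1ℚ :* y) refl
        eqn : ∀ d c x y z → z ≡
          (1ℚ + d * c) * y + (((- 1ℚ * y + 1ℚ * z) - d * x) + d * (x - c * y))
        eqn = solve 5 (λ d c x y z → z := (con 1ℚ :+ d :* c) :* y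
          :+ (((con (- 1ℚ) :* y :+ con 1ℚ :* z) :- d :* x) :+ d :* (x :- c :* y))) refl
        separated : ∀ d c n m → 0ℚ < d → d * s n < value (linear (- 1ℚ) 1ℚ) m →
          c * s m ≤ s n → (1ℚ + d * c) * s m ≤ s (suc m)
        separated d c n m 0<d h₁ h₂ = ≤-gap
          (0≤+ (gap-≤ (subst (d * s n ≤_) (value-linear (- 1ℚ) 1ℚ m) (ℚ.<⇒≤ h₁)))
               (0≤* (ℚ.<⇒≤ 0<d) (gap-≤ h₂)))
          (eqn d c (s n) (s m) (s (suc m)))

      -- The quotients themselves represent θ, so a polynomial has the root θ exactly when its
      -- values along ρ are null.
      limit : ℝ
      limit = mkℝ ρ ρ-cauchy

      ρ~limit : Null λ n → ρ n - ρ n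
      ρ~limit = null-≗ (λ n → sym (ℚ.+-inverseʳ (ρ n))) null-0

      open Quotients ρ ρ-quotient limit ρ~limit

      -- At m = n + Δ, (S2) and `contraction` force the operator above d c * s m, whereas a root
      -- makes the operator divided by `s m` eventually smaller than d c.
      root⇒not-positive : (a : Vector ℚ (suc k)) → Null (evalAlong a ρ) →
        ¬ Eventually λ n → 0ℚ < value a n
      root⇒not-positive a root pos =
        let Δ , d , 0<d , h = overtakes a pos
            c , 0<c , h′ = contraction Δ
            scaled-small = root⇒scaled-null a root (d * c) (0<* 0<d 0<c)
            factored = ev-pred {λ n → s n * scaled a n ≡ value a n} (ev-all (scaled-* a))
        in ev-⊥ (ev-map₂
             (λ n cs≤ (small , eq) → absurd d c n (n ℕ.+ Δ) 0<d (h n) cs≤ (∣∣<⇒< small) eq)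
             h′ (ev-+ Δ (ev-map₂ (λ n → _,_) scaled-small factored)))
        where
        open +-*-Solver
        eqn : ∀ d c x y p → d * x ≡ y * p + (y * (d * c - p) + d * (x - c * y))
        eqn = solve 5 (λ d c x y p →
          d :* x := y :* p :+ (y :* (d :* c :- p) :+ d :* (x :- c :* y))) refl
        absurd : ∀ d c n m → 0ℚ < d → d * s n < value a m → c * s m ≤ s n →
          scaled a m < d * c → s m * scaled a m ≡ value a m → ⊥
        absurd d c n m 0<d h₁ h₂ h₃ eq = ℚ.<-irrefl refl (ℚ.<-≤-trans
          (subst (d * s n <_) (sym eq) h₁)
          (≤-gap (0≤+ (0≤* (0≤s m) (gap-≤ (ℚ.<⇒≤ h₃))) (0≤* (ℚ.<⇒≤ 0<d) (gap-≤ h₂)))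
                 (eqn d c (s n) (s m) (scaled a m))))

      root⇒value≡0 : (a : Vector ℚ (suc k)) → Null (evalAlong a ρ) → ∀ n → value a n ≡ 0ℚ
      root⇒value≡0 a root = by-sign (signed a)
        where
        by-sign : _ → ∀ n → value a n ≡ 0ℚ
        by-sign (inj₁ ≡0)        = ≡0
        by-sign (inj₂ (inj₁ >0)) = contradiction >0 (root⇒not-positive a root)
        by-sign (inj₂ (inj₂ <0)) = contradiction
          (ev-map (λ n v<0 → subst (0ℚ <_) (sym (neg-⟨⟩ a (λ i → s (n ℕ.+ i)))) (ℚ.neg-antimono-< v<0)) <0)
          (root⇒not-positive (λ i → - a i)
            (null-≗ (λ n → sym (neg-⟨⟩ a (ρ n ^_))) (null-neg root)))

-- Operators over the integers and over the rationals

clearDenominators : (a : Vector ℚ k) →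
  ∃[ D ] (0ℚ < intℚ D × Σ (Vector ℤ k) λ b → ∀ i → intℚ (b i) ≡ intℚ D * a i)
clearDenominators {zero}  a = ℤ.+ 1 , 0<1 , (λ ()) , λ ()
clearDenominators {suc k} a =
  let D , 0<D , b , b≡ = clearDenominators (λ i → a (suc i))
      p = ℚ.↥ a zero
      q = ℚ.↧ a zero
  in D ℤ.* q
   , subst (0ℚ <_) (sym (intℚ-* D q)) (0<* 0<D (ℚ.positive⁻¹ (intℚ q)))
   , (λ { zero → D ℤ.* p ; (suc i) → q ℤ.* b i })
   , λ { zero    → trans (intℚ-* D p) (trans (cong (intℚ D *_) (sym (denominator-* (a zero))))
                     (sym (scaled D q (a zero))))
       ; (suc i) → trans (intℚ-* q (b i)) (trans (cong (intℚ q *_) (b≡ i))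
                     (trans (swap (intℚ q) (intℚ D) (a (suc i))) (sym (scaled D q (a (suc i)))))) }
  where
  scaled : ∀ D q x → intℚ (D ℤ.* q) * x ≡ intℚ D * (intℚ q * x)
  scaled D q x = trans (cong (_* x) (intℚ-* D q)) (ℚ.*-assoc (intℚ D) (intℚ q) x)

intℚ-sum : (a : Vector ℤ k) (t : ℕ → ℤ) →
  intℚ (ℤ-Sum.sum λ i → a i ℤ.* t (toℕ i)) ≡ ⟨ (λ i → intℚ (a i)) , (λ i → intℚ (t i)) ⟩
intℚ-sum {zero}  a t = refl
intℚ-sum {suc k} a t = trans (intℚ-+ (a zero ℤ.* t 0) _)
  (cong₂ _+_ (intℚ-* (a zero) (t 0)) (intℚ-sum (λ i → a (suc i)) (λ i → t (suc i))))

-- From elements of R to indices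

module Enumerated {R : Pred ℕ 0ℓ} (e : Enumeration R) where
  open Enumeration e

  r-mono : ∀ j n → r n ℕ.< r (suc (j ℕ.+ n))
  r-mono zero    n = increasing n
  r-mono (suc j) n = ℕ.<-trans (r-mono j n) (increasing (suc (j ℕ.+ n)))

  r-mono-< : ∀ {m n} → m ℕ.< n → r m ℕ.< r n
  r-mono-< {m} {n} m<n = subst (λ t → r m ℕ.< r t)
    (trans (sym (ℕ.+-suc (n ℕ.∸ suc m) m)) (ℕ.m∸n+n≡m m<n)) (r-mono (n ℕ.∸ suc m) m)

  r-injective : ∀ {m n} → r m ≡ r n → m ≡ n
  r-injective {m} {n} eq with ℕ.<-cmp m n
  ... | tri< m<n _ _ = contradiction eq (ℕ.<⇒≢ (r-mono-< m<n))
  ... | tri≈ _ m≡n _ = m≡n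
  ... | tri> _ _ n<m = contradiction (sym eq) (ℕ.<⇒≢ (r-mono-< n<m))

  n≤r : ∀ n → n ℕ.≤ r n
  n≤r zero    = ℕ.z≤n
  n≤r (suc n) = ℕ.≤-<-trans (n≤r n) (increasing n)

  indexOf : ∃ R → ℕ
  indexOf (_ , z∈R) = index z∈R

  r-indexOf : ∀ z → r (indexOf z) ≡ proj₁ z
  r-indexOf (_ , z∈R) = r-index z∈R

  element : ℕ → ∃ R
  element n = r n , r∈R n

  -- `index` takes a membership proof as its argument, but injectivity of `r` leaves it no choice of
  -- value.
  indexOf-element : ∀ n → indexOf (element n) ≡ n
  indexOf-element n = r-injective (r-indexOf (element n))

  indexOf-σ^ : ∀ j z → indexOf (σ^ e j z) ≡ indexOf z ℕ.+ j
  indexOf-σ^ zero    z = sym (ℕ.+-identityʳ (indexOf z))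
  indexOf-σ^ (suc j) z = trans (indexOf-element (suc (indexOf (σ^ e j z))))
    (trans (cong suc (indexOf-σ^ j z)) (sym (ℕ.+-suc (indexOf z) j)))

  valueℤ : Vector ℤ k → ℕ → ℤ
  valueℤ a n = ℤ-Sum.sum λ i → a i ℤ.* ℤ.+ r (n ℕ.+ toℕ i)

  operator≡valueℤ : (a : Vector ℤ (suc m)) → ∀ z → operator e a z ≡ valueℤ a (indexOf z)
  operator≡valueℤ a z = MonoidSum.sum-cong-≗ ℤ.+-0-monoid λ i → cong (λ t → a i ℤ.* ℤ.+ t)
    (trans (sym (r-indexOf (σ^ e (toℕ i) z))) (cong r (indexOf-σ^ (toℕ i) z)))

  operator-element : (a : Vector ℤ (suc m)) → ∀ n → operator e a (element n) ≡ valueℤ a n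
  operator-element a n = trans (operator≡valueℤ a (element n)) (cong (valueℤ a) (indexOf-element n))

  operator-σ^ : (a : Vector ℤ (suc m)) → ∀ Δ z →
    operator e a (σ^ e Δ z) ≡ valueℤ a (indexOf z ℕ.+ Δ)
  operator-σ^ a Δ z = trans (operator≡valueℤ a (σ^ e Δ z)) (cong (valueℤ a) (indexOf-σ^ Δ z))

  ev⇒cofinite : {A : Pred (∃ R) 0ℓ} → (∀ z → P (indexOf z) → A z) →
    Eventually P → AllButFinitelyMany e A
  -- An exception has index below N, hence lies below r N.
  ev⇒cofinite imp (N , h) = upTo (r N) , λ {z} (z∈R , ¬Az) → ∈-upTo⁺
    (subst (ℕ._< r N) (r-index z∈R)
      (r-mono-< (ℕ.≰⇒> λ N≤i → ¬Az (imp (z , z∈R) (h (index z∈R) N≤i)))))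

  -- Since n ≤ r n, every index beyond the maximum of the exceptional list gives an element outside
  -- the list. That only refutes the failure of A, so decidability of P removes the double negation.
  cofinite⇒ev : {A : Pred (∃ R) 0ℓ} → (∀ n → Dec (P n)) → (∀ n → A (element n) → P n) →
    AllButFinitelyMany e A → Eventually P
  cofinite⇒ev P? imp (xs , h) = suc (max 0 xs) , λ n N≤n → decidable-stable (P? n) λ ¬Pn →
    ℕ.<⇒≱ (ℕ.<-≤-trans N≤n (n≤r n))
      (lookup (xs≤max 0 xs) (h (r∈R n , λ An → ¬Pn (imp n An))))

  s : ℕ → ℚ
  s n = natℚ (r n)

  0≤s₀ : 0ℚ ≤ s 0
  0≤s₀ = ℚ.nonNegative⁻¹ (natℚ (r 0))

  s-increasing : ∀ n → s n < s (suc n)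
  s-increasing n = intℚ-mono-< (ℤ.+<+ (increasing n))

  open Operators s 0≤s₀ s-increasing

  rational : Vector ℤ k → Vector ℚ k
  rational a i = intℚ (a i)

  value-rational : (a : Vector ℤ k) → ∀ n → intℚ (valueℤ a n) ≡ value (rational a) n
  value-rational a n = intℚ-sum a (λ i → ℤ.+ r (n ℕ.+ i))

  quotient-* : ∀ p q → 0 ℕ.< q → quotient e p q * natℚ q ≡ natℚ p
  quotient-* p (suc q) _ = trans (ℚ.*-comm (quotient e p (suc q)) (natℚ (suc q))) (q*[p/q]≡p (ℤ.+ p) q)

  ratio-* : ∀ n → ratio e (suc n) * s (suc n) ≡ s (suc (suc n))
  ratio-* n = quotient-* _ (r (suc n)) (ℕ.≤-<-trans ℕ.z≤n (increasing n))

  -- Sparseness, transferred to operators with rational coefficients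

  trichotomy⇒sparse : ExponentialGrowth → (∀ {k} (a : Vector ℚ k) → Trichotomy a) → Sparse e
  trichotomy⇒sparse growth tri = record { S1 = λ m → S1 ; S2 = λ m → S2 }
    where
    S1 : (a : Vector ℤ (suc m)) →
      _=ᴿ0 e (operator e a) ⊎ _>ᴿ0 e (operator e a) ⊎ _<ᴿ0 e (operator e a)
    S1 a = by-cases (tri (rational a))
      where
      by-cases : Trichotomy (rational a) → _
      by-cases (inj₁ ≡0) = inj₁ λ z → trans (operator≡valueℤ a z)
        (intℚ-injective (trans (value-rational a (indexOf z)) (≡0 (indexOf z))))
      by-cases (inj₂ (inj₁ dom)) = inj₂ (inj₁ (ev⇒cofinite
        (λ z 0<v → subst (0ℤ ℤ.<_) (sym (operator≡valueℤ a z))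
          (intℚ-cancel-< (subst (0ℚ <_) (sym (value-rational a (indexOf z))) 0<v)))
        (dominates⇒positive dom)))
      by-cases (inj₂ (inj₂ dom)) = inj₂ (inj₂ (ev⇒cofinite
        (λ z 0<-v → subst (ℤ._< 0ℤ) (sym (operator≡valueℤ a z))
          (intℚ-cancel-< (subst (_< 0ℚ)
            (trans (neg-involutive _) (sym (value-rational a (indexOf z))))
            (ℚ.neg-antimono-< 0<-v))))
        (dominates⇒positive dom)))
    S2 : (a : Vector ℤ (suc m)) → _>ᴿ0 e (operator e a) →
      ∃[ Δ ] (∀ z → operator e a (σ^ e Δ z) ℤ.> ℤ.+ proj₁ z)
    S2 a A>0 =
      let Δ , h = positive⇒overtakes growth (rational a) (tri (rational a))
            (cofinite⇒ev (λ n → 0ℚ ℚ.<? value (rational a) n)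
              (λ n 0<A → subst (0ℚ <_) (value-rational a n)
                (intℚ-mono-< (subst (0ℤ ℤ.<_) (operator-element a n) 0<A)))
              A>0)
      in Δ , λ z → subst₂ ℤ._<_ (cong ℤ.+_ (r-indexOf z)) (sym (operator-σ^ a Δ z))
           (intℚ-cancel-< (subst (s (indexOf z) <_) (sym (value-rational a (indexOf z ℕ.+ Δ)))
             (h (indexOf z))))

  module FromSparse (sparse : Sparse e) where

    module Cleared (a : Vector ℚ (suc k)) (D : ℤ) (0<D : 0ℚ < intℚ D)
                   (b : Vector ℤ (suc k)) (b≡ : ∀ i → intℚ (b i) ≡ intℚ D * a i) where

      value-cleared : ∀ n → intℚ (valueℤ b n) ≡ intℚ D * value a n
      value-cleared n = trans (value-rational b n) (trans
        (sum-cong-≗ λ i → cong (_* s (n ℕ.+ toℕ i)) (b≡ i))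
        (*-⟨⟩ (intℚ D) a (λ i → s (n ℕ.+ i))))

      positive : ∀ n → 0ℤ ℤ.< valueℤ b n → 0ℚ < value a n
      positive n h = *-cancel-<ˡ 0<D
        (subst₂ _<_ (sym (ℚ.*-zeroʳ (intℚ D))) (value-cleared n) (intℚ-mono-< h))

      negative : ∀ n → valueℤ b n ℤ.< 0ℤ → value a n < 0ℚ
      negative n h = *-cancel-<ˡ 0<D
        (subst₂ _<_ (value-cleared n) (sym (ℚ.*-zeroʳ (intℚ D))) (intℚ-mono-< h))

      positiveℤ : ∀ n → 0ℚ < value a n → 0ℤ ℤ.< valueℤ b n
      positiveℤ n h = intℚ-cancel-< (subst (0ℚ <_) (sym (value-cleared n)) (0<* 0<D h))

      by-sign : _=ᴿ0 e (operator e b) ⊎ _>ᴿ0 e (operator e b) ⊎ _<ᴿ0 e (operator e b) →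
        (∀ n → value a n ≡ 0ℚ)
          ⊎ Eventually (λ n → 0ℚ < value a n) ⊎ Eventually (λ n → value a n < 0ℚ)
      by-sign (inj₁ ≡0) = inj₁ λ n → *-cancel-0 0<D (trans (sym (value-cleared n))
        (cong intℚ (trans (sym (operator-element b n)) (≡0 (element n)))))
      by-sign (inj₂ (inj₁ >0)) = inj₂ (inj₁ (cofinite⇒ev (λ n → 0ℚ ℚ.<? value a n)
        (λ n h → positive n (subst (0ℤ ℤ.<_) (operator-element b n) h)) >0))
      by-sign (inj₂ (inj₂ <0)) = inj₂ (inj₂ (cofinite⇒ev (λ n → value a n ℚ.<? 0ℚ)
        (λ n h → negative n (subst (ℤ._< 0ℤ) (operator-element b n) h)) <0))

      overtake : Eventually (λ n → 0ℚ < value a n) →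
        ∃[ Δ ] ∃[ d ] (0ℚ < d × (∀ n → d * s n < value a (n ℕ.+ Δ)))
      overtake >0 =
        let Δ , h = Sparse.S2 sparse _ b (ev⇒cofinite
              (λ z v>0 → subst (0ℤ ℤ.<_) (sym (operator≡valueℤ b z)) (positiveℤ (indexOf z) v>0)) >0)
            d , 0<d , dD≡1 = inverse-pos 0<D
        in Δ , d , 0<d , λ n → subst (d * s n <_)
             (trans (sym (ℚ.*-assoc d (intℚ D) (value a (n ℕ.+ Δ))))
               (trans (cong (_* value a (n ℕ.+ Δ)) dD≡1) (ℚ.*-identityˡ _)))
             (*-mono-< 0<d (subst (s n <_) (value-cleared (n ℕ.+ Δ)) (intℚ-mono-<
               (subst (ℤ.+ r n ℤ.<_)
                 (trans (operator-σ^ b Δ (element n))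
                   (cong (λ t → valueℤ b (t ℕ.+ Δ)) (indexOf-element n)))
                 (h (element n))))))

    signed : (a : Vector ℚ (suc k)) → (∀ n → value a n ≡ 0ℚ)
      ⊎ Eventually (λ n → 0ℚ < value a n) ⊎ Eventually (λ n → value a n < 0ℚ)
    signed a = let D , 0<D , b , b≡ = clearDenominators a in
      Cleared.by-sign a D 0<D b b≡ (Sparse.S1 sparse _ b)

    overtakes : (a : Vector ℚ (suc k)) → Eventually (λ n → 0ℚ < value a n) →
      ∃[ Δ ] ∃[ d ] (0ℚ < d × (∀ n → d * s n < value a (n ℕ.+ Δ)))
    overtakes a = let D , 0<D , b , b≡ = clearDenominators a in
      Cleared.overtake a D 0<D b b≡

-- Limits of rational sequences

⟶⇒~ : ∀ q θ → q ⟶ θ → Null λ n → q n - seq θ n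
⟶⇒~ q θ q⟶θ ε 0<ε =
  let N , h = q⟶θ (fromℚ (½ * ε)) (½ * ε , half 0<ε , ev-all λ _ → ℚ.≤-reflexive (ℚ.+-identityˡ _))
      M , close = cauchy θ (½ * ε) (half 0<ε)
  in N ℕ.⊔ M , λ n le →
    let η , 0<η , K , near = h n (ℕ.m⊔n≤o⇒m≤o N M le)
    -- Closeness of q n to the real θ speaks only of late terms of θ. An index past both K and M
    -- serves as the intermediate point between q n and the n-th term.
    in combine n (K ℕ.⊔ M) η 0<η (near (K ℕ.⊔ M) (ℕ.m≤m⊔n K M))
         (close (K ℕ.⊔ M) n (ℕ.m≤n⊔m K M) (ℕ.m⊔n≤o⇒n≤o N M le))
  where
  combine : ∀ n m η → 0ℚ < η → ∣ q n - seq θ m ∣ + η ≤ ½ * ε →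
    ∣ seq θ m - seq θ n ∣ < ½ * ε → ∣ q n - seq θ n ∣ < ε
  combine n m η 0<η h₁ h₂ = ℚ.≤-<-trans
    (subst (λ t → ∣ t ∣ ≤ ∣ q n - seq θ m ∣ + ∣ seq θ m - seq θ n ∣)
      (telescope (q n) (seq θ m) (seq θ n)) (ℚ.∣p+q∣≤∣p∣+∣q∣ (q n - seq θ m) (seq θ m - seq θ n)))
    (subst (∣ q n - seq θ m ∣ + ∣ seq θ m - seq θ n ∣ <_) (halves ε)
      (ℚ.+-mono-≤-< (ℚ.≤-trans (≤-gap {x = ∣ q n - seq θ m ∣} (ℚ.<⇒≤ 0<η) refl) h₁) h₂))

cauchy⇒⟶ : ∀ q (cq : IsCauchy q) → q ⟶ mkℝ q cq
cauchy⇒⟶ q cq ε (η , 0<η , M , η≤ε) =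
  let N , close = cq (½ * η) (half 0<η)
  -- Half of η bounds the distance; the other half is the uniform gap that `<` on the reals demands.
  in N , λ n N≤n → ½ * η , half 0<η , N ℕ.⊔ M , λ m le → ℚ.≤-trans
    (subst (∣ q n - q m ∣ + ½ * η ≤_) (halves η) (ℚ.+-monoˡ-≤ (½ * η)
      (ℚ.<⇒≤ (close n m N≤n (ℕ.m⊔n≤o⇒m≤o N M le)))))
    (subst (_≤ seq ε m) (ℚ.+-identityˡ η) (η≤ε m (ℕ.m⊔n≤o⇒n≤o N M le)))

⟶∞⇒unbounded : ∀ q → q ⟶∞ → ∀ x → Eventually λ n → x ≤ q n
⟶∞⇒unbounded q q⟶∞ x = ev-map
  (λ n (ε , 0<ε , N , h) → ℚ.≤-trans (≤-gap (ℚ.<⇒≤ 0<ε) refl) (h N ℕ.≤-refl))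
  (q⟶∞ (fromℚ x))

unbounded⇒⟶∞ : ∀ q → (∀ x → Eventually λ n → x ≤ q n) → q ⟶∞
unbounded⇒⟶∞ q unbounded M =
  let B , 0<B , N , M≤B = cauchy⇒bounded {seq M} (cauchy M)
  in ev-map (λ n h → 1ℚ , 0<1 , N , λ m N≤m → ℚ.≤-trans
       (ℚ.+-monoˡ-≤ 1ℚ (ℚ.<⇒≤ (∣∣<⇒< (ℚ.≤-<-trans (M≤B m N≤m) (<-gap 0<1 refl))))) h)
     -- One unit makes the bound on M strict, the other is the gap.
     (unbounded (B + 1ℚ + 1ℚ))

-- The two implications

module _ (em : ExcludedMiddle 0ℓ) {R : Pred ℕ 0ℓ} (e : Enumeration R) where
  open Enumeration e using (r)
  open Enumerated e
  open Operators s 0≤s₀ s-increasing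

  value-/1 : (a : Vector ℚ k) → ∀ n →
    ℚ-Sum.sum (λ i → a i * (ℤ.+ r (n ℕ.+ toℕ i) / 1)) ≡ value a n
  value-/1 a n = sum-cong-≗ λ i → cong (a i *_) (intℚ-/1 (ℤ.+ r (n ℕ.+ toℕ i)))

  ratio-lower : ∀ {q} → Eventually (λ n → q ≤ ratio e n) → Eventually λ n → q * s n ≤ s (suc n)
  ratio-lower {q} h = ev-pred {λ n → q * s n ≤ s (suc n)} (ev-map
    (λ n q≤ → subst (q * s (suc n) ≤_) (ratio-* n)
      (ℚ.*-monoʳ-≤-nonNeg (s (suc n)) {{ℚ.nonNegative (0≤s (suc n))}} q≤))
    (ev-suc h))

  ratio⇒growth : ∀ {δ} → 0ℚ < δ → Eventually (λ n → 1ℚ + δ ≤ ratio e n) → ExponentialGrowth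
  ratio⇒growth {δ} 0<δ h = δ , 0<δ , ev-map
    (λ n → subst (_≤ s (suc n)) (expand δ (s n))) (ratio-lower h)
    where
    open +-*-Solver
    expand : ∀ d x → (1ℚ + d) * x ≡ d * x + x
    expand = solve 2 (λ d x → (con 1ℚ :+ d) :* x := d :* x :+ x) refl

  regular⇒sparse : Regular e → Sparse e
  regular⇒sparse (inj₁ (θ , (ε , 0<ε , 1+ε≤θ) , ratio⟶θ , recurrence)) = trichotomy⇒sparse
    -- Half of the gap between 1 and θ is given up to pass from θ to the quotients.
    (ratio⇒growth (half 0<ε) (ev-map₂
      (λ n 1+ε≤ close → ≤-gap (0≤+ (gap-≤ 1+ε≤) (ℚ.<⇒≤ (gap-< (∣∣<⇒-< close))))
        (eqn (ratio e n) (seq θ n) (½ * ε) ε (sym (halves ε))))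
      1+ε≤θ (ρ~θ (½ * ε) (half 0<ε))))
    λ a → quotients⇒trichotomy em a (Algebraic.root⇒vanishes em θ s
      (λ k f f-min n → trans (sym (value-/1 f n)) (recurrence k f f-min n)) a)
    where
    ρ~θ : Null λ n → ratio e n - seq θ n
    ρ~θ = ⟶⇒~ (ratio e) θ ratio⟶θ
    open Quotients (ratio e) ratio-* θ ρ~θ
    eqn : ∀ r t h e → e ≡ h + h → r ≡ (1ℚ + h) + ((t - (1ℚ + e)) + (h - - (r - t)))
    eqn r t h e refl = solve 3 (λ r t h → r :=
      (con 1ℚ :+ h) :+ ((t :- (con 1ℚ :+ (h :+ h))) :+ (h :- :- (r :- t)))) refl r t h
      where open +-*-Solver
  regular⇒sparse (inj₂ ratio⟶∞) = trichotomy⇒sparse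
    (ratio⇒growth 0<1 (⟶∞⇒unbounded (ratio e) ratio⟶∞ (1ℚ + 1ℚ)))
    (superexponential⇒trichotomy λ j → ratio-lower (⟶∞⇒unbounded (ratio e) ratio⟶∞ (natℚ j)))

  sparse⇒regular : Sparse e → Regular e
  sparse⇒regular sparse = by-cases em
    where
    open FromSparse sparse
    open SparseSequence em s 0≤s₀ s-increasing (ratio e) ratio-*
    open Signed signed overtakes
    by-cases : Dec (∃ EventuallyBelow) → Regular e
    by-cases (no ¬bounded) = inj₂ (unbounded⇒⟶∞ (ratio e) (unbounded ¬bounded))
    by-cases (yes (j , ratio≤j)) = inj₁ (limit , 1<ρ , cauchy⇒⟶ (ratio e) ρ-cauchy , recurrence)
      where
      open BoundedRatio j ratio≤j
      recurrence : ∀ k (a : Vector ℚ (suc k)) → IsMinimalPolynomial a limit →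
        ∀ n → ℚ-Sum.sum (λ i → a i * (ℤ.+ r (n ℕ.+ toℕ i) / 1)) ≡ 0ℚ
      recurrence k a a-min n = trans (value-/1 a n)
        (root⇒value≡0 a (eval≈0⇒null a limit (IsMinimalPolynomial.root a-min)) n)

mainTheorem8 : (em : ExcludedMiddle 0ℓ) (R : Pred ℕ 0ℓ) (inf : Infinite R) →
    Sparse (enumeration em {R} inf) ⇔ Regular (enumeration em {R} inf)
mainTheorem8 em R inf =
  mk⇔ (sparse⇒regular em (enumeration em inf)) (regular⇒sparse em (enumeration em inf))
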